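{- Let $q$ be a prime power, let $r$ be a positive integer, and let $c=(c_1,\dots,c_r)$ be nonnegative integers with $c_1+\dots+c_r=r$. Then \[\deg_{\mathrm{PG}(r,q)}\big(\gamma_{(1)_q}^{c_1}\gamma_{(2)_q}^{c_2}\cdots\gamma_{(r)_q}^{c_r}\big)=q^{\binom{r+1}{2}}A_c(q).\]
   Context: $(m)_q=1+q+\dots+q^{m-1}$ and $(m)_q!=\prod_{i=1}^m(i)_q$. $\mathrm{PG}(r,q)$ is the matroid on the ground set $E=\mathbb{P}^r(\mathbb{F}_q)$ (of size $n+1=(r+1)_q$) in which the rank of $S$ is one plus the dimension of its projective span; its rank-$k$ flats are the $(k-1)$-dimensional projective subspaces, each with $(k)_q$ elements. For a loopless matroid $M$ of rank $r+1$ on a finite set $E$ with $|E|=n+1$, the Chow ring $A^*(M)$ (real coefficients) is $\mathbb{R}[x_F : F \text{ a nonempty proper flat}]$ modulo the ideal generated by all $x_{F_1}x_{F_2}$ with $F_1,F_2$ incomparable and all $\sum_{F\ni i}x_F-\sum_{F\ni j}x_F$ for $i,j\in E$; $\deg_M:A^r(M)\to\mathbb{R}$ is the linear map with value $1$ on $x_{F_1}\cdots x_{F_r}$ for each complete flag of flats. For $S\subseteq E$, $x_S$ means the generator if $S$ is a nonempty proper flat and $0$ otherwise. Hypersimplex classes: $\gamma_k=\sum_S\left(\min(|S|,k)-\frac{k}{n+1}|S|\right)x_S$ for $1\le k\le n$ (sum over nonempty proper $S\subsetneq E$). The remixed Eulerian polynomials $A_c(q)$, for $c$ in $\mathcal{W}_r=\{(c_1,\dots,c_r)\in\mathbb{Z}_{\ge0}^r: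 c_1+\dots+c_r=r\}$, are the polynomials characterized by $A_{(1,\dots,1)}(q)=(r)_q!$ and, whenever $c_i\ge2$, $(q+1)A_c(q)=qA_{c-e_i+e_{i-1}}(q)+A_{c-e_i+e_{i+1}}(q)$, where a term whose index vector has a positive entry in position $0$ or $r+1$ is taken to be $0$. -}

module Defs where

open import Level using (0ℓ)
open import Data.Nat as ℕ using (ℕ; zero; suc; _⊓_; _<_; _≤_; _^_; _<?_)
open import Data.Nat.Combinatorics using (_C_)
open import Data.Nat.ListAction using (sum)
open import Data.Integer as ℤ using (ℤ)
open import Data.Rational as ℚ using (ℚ; 0ℚ; 1ℚ)
open import Data.Fin using (Fin)
open import Data.Fin.Subset using (Subset; _∈_; _∉_; _⊆_; _⊂_; ∣_∣; inside; outside; Side)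
open import Data.Vec as V using (Vec; lookup)
open import Data.List as L using (List; []; _∷_; _++_; length; map; concatMap; replicate)
open import Data.List.Relation.Binary.Permutation.Propositional using (_↭_)
open import Data.List.Relation.Unary.All using (All)
open import Data.List.Relation.Unary.Linked using (Linked)
open import Data.Product using (Σ; ∃; _×_; _,_)
open import Relation.Nullary using (¬_; yes; no)
open import Relation.Binary.PropositionalEquality using (_≡_; _≢_)
open import Algebra.Structures using (IsCommutativeRing)
open import Function.Bundles using (_↔_)

qint : ℕ → ℕ → ℕ
qint q zero    = 0
qint q (suc m) = q ^ m ℕ.+ qint q m

qfact : ℕ → ℕ → ℕ
qfact q zero    = 1
qfact q (suc m) = qint q (suc m) ℕ.* qfact q m

record FiniteField (q : ℕ) : Set₁ where
  infixl 6 _+_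
  infixl 7 _*_
  field
    Carrier : Set
    _+_ _*_ : Carrier → Carrier → Carrier
    -_      : Carrier → Carrier
    0# 1#   : Carrier
    isCommutativeRing : IsCommutativeRing _≡_ _+_ _*_ -_ 0# 1#
    0≢1     : 0# ≢ 1#
    inverse : ∀ x → x ≢ 0# → ∃ λ y → x * y ≡ 1#
    enum    : Fin q ↔ Carrier

module _ {q : ℕ} (F : FiniteField q) where
  open FiniteField F

  zeroV : ∀ {m} → Vec Carrier m
  zeroV = V.replicate _ 0#

  scale : ∀ {m} → Carrier → Vec Carrier m → Vec Carrier m
  scale a = V.map (a *_)

  addV : ∀ {m} → Vec Carrier m → Vec Carrier m → Vec Carrier m
  addV = V.zipWith _+_

  -- pt : Fin N → F^(r+1) is a system of representatives of the points of
  -- the projective space P^r(F): pt i ≠ 0, every nonzero vector is a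
  -- multiple of some pt i, and distinct indices give distinct points.
  record IsProjRep (r N : ℕ) (pt : Fin N → Vec Carrier (suc r)) : Set where
    field
      nonzero  : ∀ i → pt i ≢ zeroV
      covers   : ∀ v → v ≢ zeroV → ∃ λ i → ∃ λ a → v ≡ scale a (pt i)
      distinct : ∀ i j a → pt i ≡ scale a (pt j) → i ≡ j

  -- projective subspaces (as sets of points): closed under taking points
  -- on the projective line through two of its points
  IsProjSubspace : ∀ {r N} → (Fin N → Vec Carrier (suc r)) → Subset N → Set
  IsProjSubspace pt S =
    ∀ i j k → i ∈ S → j ∈ S →
      (∃ λ a → ∃ λ b → pt k ≡ addV (scale a (pt i)) (scale b (pt j))) → k ∈ S

allSubsets : (n : ℕ) → List (Subset n)
allSubsets zero    = V.[] ∷ []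
allSubsets (suc n) = map (inside V.∷_) (allSubsets n) ++ map (outside V.∷_) (allSubsets n)

Nonempty : ∀ {n} → Subset n → Set
Nonempty S = ∃ λ x → x ∈ S

Proper : ∀ {n} → Subset n → Set
Proper S = ∃ λ x → x ∉ S

ℕtoℚ : ℕ → ℚ
ℕtoℚ n = ℤ.+ n ℚ./ 1

sumℚ : List ℚ → ℚ
sumℚ = L.foldr ℚ._+_ 0ℚ

-- Polynomials in the variables x_S (S ⊆ E) with rational coefficients,
-- as formal sums of (coefficient , monomial); a monomial is a list of
-- variables (commutativity is imposed on the functional below).

Poly : ℕ → Set
Poly N = List (ℚ × List (Subset N))

onePoly : ∀ {N} → Poly N
onePoly = (1ℚ , []) ∷ []

_*P_ : ∀ {N} → Poly N → Poly N → Poly N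
p *P p' = concatMap (λ { (c , m) → map (λ { (c' , m') → (c ℚ.* c' , m ++ m') }) p' }) p

_^P_ : ∀ {N} → Poly N → ℕ → Poly N
p ^P zero  = onePoly
p ^P suc k = p *P (p ^P k)

evalP : ∀ {N} → (List (Subset N) → ℚ) → Poly N → ℚ
evalP D p = sumℚ (map (λ { (c , m) → c ℚ.* D m }) p)

divℕ : ℕ → ℕ → ℚ
divℕ a zero    = 0ℚ
divℕ a (suc d) = ℤ.+ a ℚ./ suc d

-- hypersimplex class γ_k = Σ_S (min(|S|,k) - k|S|/N) x_S, N = |E| = n+1
-- (sum over all S ⊆ E; the terms S = ∅, E vanish since x_∅ = x_E = 0)
gamma : (N k : ℕ) → Poly N
gamma N k = map (λ S → (ℕtoℚ (∣ S ∣ ⊓ k) ℚ.- divℕ (k ℕ.* ∣ S ∣) N , S ∷ [])) (allSubsets N)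

gammaMonoFrom : (N q : ℕ) → ℕ → List ℕ → Poly N
gammaMonoFrom N q i []      = onePoly
gammaMonoFrom N q i (c ∷ cs) = (gamma N (qint q i) ^P c) *P gammaMonoFrom N q (suc i) cs

gammaMono : (N q : ℕ) → List ℕ → Poly N
gammaMono N q = gammaMonoFrom N q 1

-- The degree map of the Chow ring A*(M) for the matroid on E = Fin N whose
-- nonempty proper flats are given by the predicate NPFlat, of rank r+1:
-- D is a linear functional on degree-r polynomials (given on monomials,
-- symmetric), vanishing on the degree-r part of the defining ideal
-- (and on monomials containing x_S for S not a nonempty proper flat),
-- and equal to 1 on every complete flag x_{F_1}⋯x_{F_r}.

sel : Side → ℚ → ℚ
sel inside  x = x
sel outside x = 0ℚ

record IsDegreeMap {N : ℕ} (r : ℕ) (NPFlat : Subset N → Set)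
                   (D : List (Subset N) → ℚ) : Set where
  field
    symmetric : ∀ m m' → length m ≡ r → m ↭ m' → D m ≡ D m'
    nonFlat   : ∀ S m → suc (length m) ≡ r → ¬ NPFlat S → D (S ∷ m) ≡ 0ℚ
    incomp    : ∀ S T m → suc (suc (length m)) ≡ r → ¬ (S ⊆ T) → ¬ (T ⊆ S) →
                D (S ∷ T ∷ m) ≡ 0ℚ
    linear    : ∀ (i j : Fin N) m → suc (length m) ≡ r →
                sumℚ (map (λ S → sel (lookup S i) (D (S ∷ m))) (allSubsets N))
                ≡ sumℚ (map (λ S → sel (lookup S j) (D (S ∷ m))) (allSubsets N))
    flag      : ∀ fl → length fl ≡ r → All NPFlat fl → Linked _⊂_ fl → D fl ≡ 1ℚ

-- Remixed Eulerian numbers at q: a family a indexed by c = (c_1,…,c_r)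
-- (lists of length r) satisfying the defining relations evaluated at q.

decAt : List ℕ → ℕ → List ℕ
decAt []       i       = []
decAt (x ∷ xs) zero    = ℕ.pred x ∷ xs
decAt (x ∷ xs) (suc i) = x ∷ decAt xs i

incAt : List ℕ → ℕ → List ℕ
incAt []       i       = []
incAt (x ∷ xs) zero    = suc x ∷ xs
incAt (x ∷ xs) (suc i) = x ∷ incAt xs i

nth : List ℕ → ℕ → ℕ
nth []       i       = 0
nth (x ∷ xs) zero    = x
nth (x ∷ xs) (suc i) = nth xs i

leftTerm : ℕ → (List ℕ → ℚ) → List ℕ → ℕ → ℚ
leftTerm q a c zero    = 0ℚ
leftTerm q a c (suc j) = ℕtoℚ q ℚ.* a (incAt (decAt c (suc j)) j)

rightTerm : ℕ → (List ℕ → ℚ) → List ℕ → ℕ → ℚ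
rightTerm r a c i with suc i <? r
... | yes _ = a (incAt (decAt c i) (suc i))
... | no  _ = 0ℚ

record IsRemixedEulerianAt (q r : ℕ) (a : List ℕ → ℚ) : Set where
  field
    base : a (replicate r 1) ≡ ℕtoℚ (qfact q r)
    step : ∀ c i → length c ≡ r → sum c ≡ r → i < r → 2 ≤ nth c i →
           ℕtoℚ (suc q) ℚ.* a c ≡ leftTerm q a c i ℚ.+ rightTerm r a c i

{-# OPTIONS --safe #-}
module Submission where

-- Call a functional f on monomials that respects the relations of the Chow ring a Chow functional; multiplication by a
-- class γ_k turns a Chow functional of degree d + 1 into one of degree d.
-- * γ_k x_F = 0 whenever |F| = k: modulo the linear relations, γ_k is the sum of (min(|S|,k) - |S ∩ F|) x_S, whose
--   coefficients vanish on all S comparable with F.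
-- * On flats, (q+1) γ_{(i)} - q γ_{(i-1)} - γ_{(i+1)} is supported on those with (i)_q elements, hence is annihilated by
--   γ_{(i)}; as γ_{(0)} = γ_{(r+1)} = 0, the degrees satisfy the relations of the remixed Eulerian numbers.
-- * For c = (1,…,1), multiply a flag of flats ending in F, of rank k, by γ_{(k+1)} ⋯ γ_{(r)}. Flats of rank above k + 1
--   are killed by the later classes, and on the others min(|S|,(k+1)_q) = |S| is linear, so γ_{(k+1)} acts as
--   N - (k+1)_q = q^{k+1} (r-k)_q times the sum of all x_S with p ∈ S. For p outside F only the join of F and p
--   survives, which extends the flag.
-- * The relations with their initial value determine the numbers, by a maximum principle.
-- The matroid enters only through the fact that the join of a flat F and a point outside F has q |F| + 1 points.
open import Defs
open import Data.Nat as ℕ using (ℕ; zero; suc; _≤_; _<_; _⊓_; _<?_; z≤n; s≤s; NonZero; _^_)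
import Data.Nat.Properties as ℕₚ
open import Data.Nat.Combinatorics using (_C_; nC1≡n; nCk+nC[k+1]≡[n+1]C[k+1])
open import Data.Nat.ListAction using (sum)
open import Data.Nat.Solver using () renaming (module +-*-Solver to ℕ-Solver)
import Data.Integer as ℤ
import Data.Integer.Properties as ℤₚ
open import Data.Rational as ℚ using (ℚ; 0ℚ; 1ℚ)
import Data.Rational.Properties as ℚₚ
open import Data.Rational.Solver using () renaming (module +-*-Solver to ℚ-Solver)
import Data.Rational.Unnormalised as ℚᵘ
import Data.Rational.Unnormalised.Properties as ℚᵘₚ
open import Data.Fin as Fin using (Fin; zero; suc; toℕ; fromℕ<; combine; remQuot)
import Data.Fin.Properties as Finₚ
open import Data.Fin.Subset using (Subset; inside; outside; ∣_∣; _∩_; _⊆_; _⊂_; ⊤; ⊥; _∈_; _∉_)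
open import Data.Fin.Subset.Properties using (_∈?_; _⊆?_; ∩-identityʳ; ∣⊤∣≡n; ∣⊥∣≡0; p⊆q⇒∣p∣≤∣q∣; p⊂q⇒∣p∣<∣q∣; ∣p∣≤n; ⊆-antisym; p∩q⊆p; p∩q⊆q; x∈p∩q⁺; ⊥⊆; ∉⊥; ⊆⊤; ∈⊤; Empty-unique)
open import Data.Vec as V using (Vec; []; _∷_; lookup; here; there; _[_]≔_)
import Data.Vec.Properties as Vₚ
open import Data.List as L using (List; []; _∷_; _++_; map; length; replicate)
open import Data.List.Properties using (map-∘; length-++; length-replicate; ++-identityʳ)
open import Data.List.Membership.Propositional using () renaming (_∈_ to _∈ˡ_)
open import Data.List.Membership.Propositional.Properties using (∈-map⁺; ∈-++⁺ˡ; ∈-++⁺ʳ)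
open import Data.List.Relation.Unary.Any using (here; there)
open import Data.List.Relation.Unary.All as All using (All; []; _∷_)
import Data.List.Relation.Unary.All.Properties as Allₚ
open import Data.List.Relation.Unary.Linked using (Linked; []; [-]; _∷_; tail)
open import Data.List.Relation.Binary.Permutation.Propositional using (_↭_; prep; swap; ↭-sym) renaming (refl to ↭-refl; trans to ↭-trans)
open import Data.List.Relation.Binary.Permutation.Propositional.Properties using (↭-length; ↭-reverse; shift; ++⁺ˡ; ∈-resp-↭; All-resp-↭)
open import Relation.Binary.Bundles using (DecTotalOrder)
import Data.List.Extrema (DecTotalOrder.totalOrder ℚₚ.≤-decTotalOrder) as Extrema
open import Data.Product using (∃; _×_; _,_; proj₁; proj₂)
open import Data.Sum using (_⊎_; inj₁; inj₂)
open import Data.Empty using (⊥-elim)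
open import Function using (_∘_)
open import Function.Bundles using (Inverse)
open import Function.Properties.Inverse using (↔-sym; ↔⇒↣)
open import Algebra.Bundles using (CommutativeRing)
import Algebra.Properties.Ring as RingProperties
open import Relation.Nullary using (¬_; Dec; yes; no; does; contradiction; ¬?; _×-dec_; _→-dec_)
open import Relation.Nullary.Decidable using (decidable-stable; via-injection; dec-true)
open import Relation.Binary.Definitions using (tri<; tri≈; tri>)
open import Relation.Binary.PropositionalEquality hiding (J)

-- Rational sums

-- Since `ℚ./` reduces its fraction to lowest terms, identities between such quotients are
-- transported to unnormalised rationals, where they become cross-multiplied integer equations.
toℚᵘ-ℕ/ : ∀ a d → ℚ.toℚᵘ (ℤ.+ a ℚ./ suc d) ℚᵘ.≃ ℚᵘ.mkℚᵘ (ℤ.+ a) d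
toℚᵘ-ℕ/ a d = ℚₚ.toℚᵘ-fromℚᵘ (ℚᵘ.mkℚᵘ (ℤ.+ a) d)

ℕtoℚ-+ : ∀ m n → ℕtoℚ (m ℕ.+ n) ≡ ℕtoℚ m ℚ.+ ℕtoℚ n
ℕtoℚ-+ m n = ℚₚ.toℚᵘ-injective (begin
  ℚ.toℚᵘ (ℕtoℚ (m ℕ.+ n))                 ≈⟨ toℚᵘ-ℕ/ (m ℕ.+ n) 0 ⟩
  ℚᵘ.mkℚᵘ (ℤ.+ (m ℕ.+ n)) 0               ≈⟨ ℚᵘ.*≡* (cong (ℤ._* ℤ.+ 1) (sym (cong₂ ℤ._+_ (ℤₚ.*-identityʳ (ℤ.+ m)) (ℤₚ.*-identityʳ (ℤ.+ n))))) ⟩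
  ℚᵘ.mkℚᵘ (ℤ.+ m) 0 ℚᵘ.+ ℚᵘ.mkℚᵘ (ℤ.+ n) 0 ≈⟨ ℚᵘₚ.+-cong (toℚᵘ-ℕ/ m 0) (toℚᵘ-ℕ/ n 0) ⟨
  ℚ.toℚᵘ (ℕtoℚ m) ℚᵘ.+ ℚ.toℚᵘ (ℕtoℚ n)    ≈⟨ ℚₚ.toℚᵘ-homo-+ (ℕtoℚ m) (ℕtoℚ n) ⟨
  ℚ.toℚᵘ (ℕtoℚ m ℚ.+ ℕtoℚ n)              ∎)
  where open import Relation.Binary.Reasoning.Setoid ℚᵘₚ.≃-setoid

ℕtoℚ-* : ∀ m n → ℕtoℚ (m ℕ.* n) ≡ ℕtoℚ m ℚ.* ℕtoℚ n
ℕtoℚ-* m n = ℚₚ.toℚᵘ-injective (begin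
  ℚ.toℚᵘ (ℕtoℚ (m ℕ.* n))                 ≈⟨ toℚᵘ-ℕ/ (m ℕ.* n) 0 ⟩
  ℚᵘ.mkℚᵘ (ℤ.+ (m ℕ.* n)) 0               ≈⟨ ℚᵘ.*≡* (cong (ℤ._* ℤ.+ 1) (ℤₚ.pos-* m n)) ⟩
  ℚᵘ.mkℚᵘ (ℤ.+ m) 0 ℚᵘ.* ℚᵘ.mkℚᵘ (ℤ.+ n) 0 ≈⟨ ℚᵘₚ.*-cong (toℚᵘ-ℕ/ m 0) (toℚᵘ-ℕ/ n 0) ⟨
  ℚ.toℚᵘ (ℕtoℚ m) ℚᵘ.* ℚ.toℚᵘ (ℕtoℚ n)    ≈⟨ ℚₚ.toℚᵘ-homo-* (ℕtoℚ m) (ℕtoℚ n) ⟨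
  ℚ.toℚᵘ (ℕtoℚ m ℚ.* ℕtoℚ n)              ∎)
  where open import Relation.Binary.Reasoning.Setoid ℚᵘₚ.≃-setoid

divℕ-* : ∀ a n → .{{NonZero n}} → divℕ a n ℚ.* ℕtoℚ n ≡ ℕtoℚ a
divℕ-* a (suc d) = ℚₚ.toℚᵘ-injective (begin
  ℚ.toℚᵘ (divℕ a (suc d) ℚ.* ℕtoℚ (suc d))      ≈⟨ ℚₚ.toℚᵘ-homo-* (divℕ a (suc d)) (ℕtoℚ (suc d)) ⟩
  ℚ.toℚᵘ (divℕ a (suc d)) ℚᵘ.* ℚ.toℚᵘ (ℕtoℚ (suc d)) ≈⟨ ℚᵘₚ.*-cong (toℚᵘ-ℕ/ a d) (toℚᵘ-ℕ/ (suc d) 0) ⟩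
  ℚᵘ.mkℚᵘ (ℤ.+ a) d ℚᵘ.* ℚᵘ.mkℚᵘ (ℤ.+ suc d) 0 ≈⟨ ℚᵘ.*≡* (trans (ℤₚ.*-identityʳ _) (cong (ℤ.+ a ℤ.*_) (cong ℤ.+_ (sym (ℕₚ.*-identityʳ (suc d)))))) ⟩
  ℚᵘ.mkℚᵘ (ℤ.+ a) 0                             ≈⟨ toℚᵘ-ℕ/ a 0 ⟨
  ℚ.toℚᵘ (ℕtoℚ a)                               ∎)
  where open import Relation.Binary.Reasoning.Setoid ℚᵘₚ.≃-setoid

divℕ-scale : ∀ k a n → .{{NonZero n}} → divℕ (k ℕ.* a) n ≡ divℕ k n ℚ.* ℕtoℚ a
divℕ-scale k a (suc d) = ℚₚ.toℚᵘ-injective (begin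
  ℚ.toℚᵘ (divℕ (k ℕ.* a) (suc d))               ≈⟨ toℚᵘ-ℕ/ (k ℕ.* a) d ⟩
  ℚᵘ.mkℚᵘ (ℤ.+ (k ℕ.* a)) d                     ≈⟨ ℚᵘ.*≡* (cong₂ ℤ._*_ (ℤₚ.pos-* k a) (cong ℤ.+_ (ℕₚ.*-identityʳ (suc d)))) ⟩
  ℚᵘ.mkℚᵘ (ℤ.+ k) d ℚᵘ.* ℚᵘ.mkℚᵘ (ℤ.+ a) 0      ≈⟨ ℚᵘₚ.*-cong (toℚᵘ-ℕ/ k d) (toℚᵘ-ℕ/ a 0) ⟨
  ℚ.toℚᵘ (divℕ k (suc d)) ℚᵘ.* ℚ.toℚᵘ (ℕtoℚ a)  ≈⟨ ℚₚ.toℚᵘ-homo-* (divℕ k (suc d)) (ℕtoℚ a) ⟨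
  ℚ.toℚᵘ (divℕ k (suc d) ℚ.* ℕtoℚ a)            ∎)
  where open import Relation.Binary.Reasoning.Setoid ℚᵘₚ.≃-setoid

∑ : ∀ {A : Set} → List A → (A → ℚ) → ℚ
∑ xs f = sumℚ (map f xs)

∑-cong : ∀ {A : Set} (xs : List A) {f g : A → ℚ} → (∀ x → f x ≡ g x) → ∑ xs f ≡ ∑ xs g
∑-cong []       f≡g = refl
∑-cong (x ∷ xs) f≡g = cong₂ ℚ._+_ (f≡g x) (∑-cong xs f≡g)

∑-zero : ∀ {A : Set} (xs : List A) {f : A → ℚ} → (∀ x → f x ≡ 0ℚ) → ∑ xs f ≡ 0ℚ
∑-zero []       f≡0 = refl
∑-zero (x ∷ xs) f≡0 = trans (cong₂ ℚ._+_ (f≡0 x) (∑-zero xs f≡0)) (ℚₚ.+-identityˡ 0ℚ)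

∑-+ : ∀ {A : Set} (xs : List A) (f g : A → ℚ) → ∑ xs (λ x → f x ℚ.+ g x) ≡ ∑ xs f ℚ.+ ∑ xs g
∑-+ []       f g = sym (ℚₚ.+-identityˡ 0ℚ)
∑-+ (x ∷ xs) f g = trans (cong (f x ℚ.+ g x ℚ.+_) (∑-+ xs f g))
  (solve 4 (λ a b c d → (a :+ b) :+ (c :+ d) := (a :+ c) :+ (b :+ d)) refl (f x) (g x) (∑ xs f) (∑ xs g))
  where open ℚ-Solver

∑-*ˡ : ∀ {A : Set} (xs : List A) a (f : A → ℚ) → ∑ xs (λ x → a ℚ.* f x) ≡ a ℚ.* ∑ xs f
∑-*ˡ []       a f = sym (ℚₚ.*-zeroʳ a)
∑-*ˡ (x ∷ xs) a f = trans (cong (a ℚ.* f x ℚ.+_) (∑-*ˡ xs a f)) (sym (ℚₚ.*-distribˡ-+ a (f x) (∑ xs f)))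

∑-swap : ∀ {A B : Set} (xs : List A) (ys : List B) (f : A → B → ℚ) →
         ∑ xs (λ x → ∑ ys (f x)) ≡ ∑ ys (λ y → ∑ xs (λ x → f x y))
∑-swap []       ys f = sym (∑-zero ys (λ _ → refl))
∑-swap (x ∷ xs) ys f = trans (cong (∑ ys (f x) ℚ.+_) (∑-swap xs ys f)) (sym (∑-+ ys (f x) (λ y → ∑ xs (λ x′ → f x′ y))))

∑-++ : ∀ {A : Set} (xs ys : List A) (f : A → ℚ) → ∑ (xs ++ ys) f ≡ ∑ xs f ℚ.+ ∑ ys f
∑-++ []       ys f = sym (ℚₚ.+-identityˡ _)
∑-++ (x ∷ xs) ys f = trans (cong (f x ℚ.+_) (∑-++ xs ys f)) (sym (ℚₚ.+-assoc (f x) (∑ xs f) (∑ ys f)))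

∑-map : ∀ {A B : Set} (h : A → B) (xs : List A) (f : B → ℚ) → ∑ (map h xs) f ≡ ∑ xs (f ∘ h)
∑-map h xs f = cong sumℚ (sym (map-∘ xs))

∑-single : ∀ {n} (J : Subset n) (f : Subset n → ℚ) → (∀ S → S ≢ J → f S ≡ 0ℚ) → ∑ (allSubsets n) f ≡ f J
∑-single V.[] f z = ℚₚ.+-identityʳ (f V.[])
∑-single {suc n} (s V.∷ J) f z = begin
  ∑ (map (inside V.∷_) (allSubsets n) ++ map (outside V.∷_) (allSubsets n)) f ≡⟨ ∑-++ (map (inside V.∷_) (allSubsets n)) _ f ⟩
  ∑ (map (inside V.∷_) (allSubsets n)) f ℚ.+ ∑ (map (outside V.∷_) (allSubsets n)) f
    ≡⟨ cong₂ ℚ._+_ (∑-map (inside V.∷_) (allSubsets n) f) (∑-map (outside V.∷_) (allSubsets n) f) ⟩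
  ∑ (allSubsets n) (f ∘ (inside V.∷_)) ℚ.+ ∑ (allSubsets n) (f ∘ (outside V.∷_)) ≡⟨ split s z ⟩
  f (s V.∷ J) ∎
  where
  open ≡-Reasoning
  tail≢ : ∀ {t S} → S ≢ J → t V.∷ S ≢ t V.∷ J
  tail≢ S≢J refl = S≢J refl
  split : ∀ s → (∀ S → S ≢ s V.∷ J → f S ≡ 0ℚ) →
          ∑ (allSubsets n) (f ∘ (inside V.∷_)) ℚ.+ ∑ (allSubsets n) (f ∘ (outside V.∷_)) ≡ f (s V.∷ J)
  split inside z = trans (cong₂ ℚ._+_ (∑-single J _ (λ S S≢J → z _ (tail≢ S≢J))) (∑-zero (allSubsets n) (λ S → z _ (λ ())))) (ℚₚ.+-identityʳ _)
  split outside z = trans (cong₂ ℚ._+_ (∑-zero (allSubsets n) (λ S → z _ (λ ()))) (∑-single J _ (λ S S≢J → z _ (tail≢ S≢J)))) (ℚₚ.+-identityˡ _)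

∣∩∣-uncons : ∀ {n} s (U : Subset n) (S : Subset (suc n)) y →
  ℕtoℚ ∣ S ∩ (s V.∷ U) ∣ ℚ.* y ≡ sel s (sel (lookup S zero) y) ℚ.+ ℕtoℚ ∣ V.tail S ∩ U ∣ ℚ.* y
∣∩∣-uncons inside  U (inside  V.∷ S) y = trans (cong (ℚ._* y) (ℕtoℚ-+ 1 ∣ S ∩ U ∣))
  (trans (ℚₚ.*-distribʳ-+ y 1ℚ (ℕtoℚ ∣ S ∩ U ∣)) (cong (ℚ._+ (ℕtoℚ ∣ S ∩ U ∣ ℚ.* y)) (ℚₚ.*-identityˡ y)))
∣∩∣-uncons inside  U (outside V.∷ S) y = sym (ℚₚ.+-identityˡ _)
∣∩∣-uncons outside U (inside  V.∷ S) y = sym (ℚₚ.+-identityˡ _)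
∣∩∣-uncons outside U (outside V.∷ S) y = sym (ℚₚ.+-identityˡ _)

lookup-tail : ∀ {n} (S : Subset (suc n)) i → lookup (V.tail S) i ≡ lookup S (suc i)
lookup-tail (_ V.∷ S) i = refl

-- Double counting: `|s x ∩ U|` counts the `i ∈ U` lying in `s x`, so exchanging the sums leaves one
-- copy of `α` for each `i ∈ U`. The hypothesis is the form in which the linear relations of the
-- Chow ring enter. The induction splits off one possible element of `U` at a time.
∑-∣∩∣ : ∀ {A : Set} {n} (U : Subset n) (xs : List A) (s : A → Subset n) (f : A → ℚ) (α : ℚ) →
  (∀ i → ∑ xs (λ x → sel (lookup (s x) i) (f x)) ≡ α) →
  ∑ xs (λ x → ℕtoℚ ∣ s x ∩ U ∣ ℚ.* f x) ≡ ℕtoℚ ∣ U ∣ ℚ.* α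
∑-∣∩∣ V.[] xs s f α hyp = trans (∑-zero xs (λ x → lem (s x) (f x))) (sym (ℚₚ.*-zeroˡ α))
  where
  lem : ∀ (S : Subset 0) y → ℕtoℚ ∣ S ∩ V.[] ∣ ℚ.* y ≡ 0ℚ
  lem V.[] y = ℚₚ.*-zeroˡ y
∑-∣∩∣ (u V.∷ U) xs s f α hyp = begin
  ∑ xs (λ x → ℕtoℚ ∣ s x ∩ (u V.∷ U) ∣ ℚ.* f x) ≡⟨ ∑-cong xs (λ x → ∣∩∣-uncons u U (s x) (f x)) ⟩
  ∑ xs (λ x → sel u (sel (lookup (s x) zero) (f x)) ℚ.+ ℕtoℚ ∣ V.tail (s x) ∩ U ∣ ℚ.* f x)
    ≡⟨ ∑-+ xs (λ x → sel u (sel (lookup (s x) zero) (f x))) (λ x → ℕtoℚ ∣ V.tail (s x) ∩ U ∣ ℚ.* f x) ⟩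
  ∑ xs (λ x → sel u (sel (lookup (s x) zero) (f x))) ℚ.+ ∑ xs (λ x → ℕtoℚ ∣ V.tail (s x) ∩ U ∣ ℚ.* f x)
    ≡⟨ cong₂ ℚ._+_ (head-sum u) (∑-∣∩∣ U xs (V.tail ∘ s) f α
         (λ i → trans (∑-cong xs (λ x → cong (λ b → sel b (f x)) (lookup-tail (s x) i))) (hyp (suc i)))) ⟩
  sel u α ℚ.+ ℕtoℚ ∣ U ∣ ℚ.* α ≡⟨ recombine u ⟩
  ℕtoℚ ∣ u V.∷ U ∣ ℚ.* α ∎
  where
  open ≡-Reasoning
  head-sum : ∀ u → ∑ xs (λ x → sel u (sel (lookup (s x) zero) (f x))) ≡ sel u α
  head-sum inside  = hyp zero
  head-sum outside = ∑-zero xs (λ _ → refl)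
  recombine : ∀ u → sel u α ℚ.+ ℕtoℚ ∣ U ∣ ℚ.* α ≡ ℕtoℚ ∣ u V.∷ U ∣ ℚ.* α
  recombine inside = sym (trans (cong (ℚ._* α) (ℕtoℚ-+ 1 ∣ U ∣))
    (trans (ℚₚ.*-distribʳ-+ α 1ℚ (ℕtoℚ ∣ U ∣)) (cong (ℚ._+ (ℕtoℚ ∣ U ∣ ℚ.* α)) (ℚₚ.*-identityˡ α))))
  recombine outside = ℚₚ.+-identityˡ _

-- Uniqueness of the remixed Eulerian numbers

length-incAt : ∀ c i → length (incAt c i) ≡ length c
length-incAt []      i       = refl
length-incAt (x ∷ c) zero    = refl
length-incAt (x ∷ c) (suc i) = cong suc (length-incAt c i)

length-decAt : ∀ c i → length (decAt c i) ≡ length c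
length-decAt []      i       = refl
length-decAt (x ∷ c) zero    = refl
length-decAt (x ∷ c) (suc i) = cong suc (length-decAt c i)

sum-incAt : ∀ c i → i < length c → sum (incAt c i) ≡ suc (sum c)
sum-incAt (x ∷ c) zero    _         = refl
sum-incAt (x ∷ c) (suc i) (s≤s i<l) = trans (cong (x ℕ.+_) (sum-incAt c i i<l)) (ℕₚ.+-suc x (sum c))

sum-decAt : ∀ c i → 1 ≤ nth c i → suc (sum (decAt c i)) ≡ sum c
sum-decAt (suc x ∷ c) zero    _  = refl
sum-decAt (x ∷ c)     (suc i) 1≤ = trans (sym (ℕₚ.+-suc x (sum (decAt c i)))) (cong (x ℕ.+_) (sum-decAt c i 1≤))

record Composition (r : ℕ) (c : List ℕ) : Set where
  constructor comp
  field
    length≡ : length c ≡ r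
    sum≡    : sum c ≡ r

move-composition : ∀ {r c} i j → Composition r c → 1 ≤ nth c i → j < r → Composition r (incAt (decAt c i) j)
move-composition {r} {c} i j (comp l s) 1≤ j<r = comp
  (trans (length-incAt (decAt c i) j) (trans (length-decAt c i) l))
  (trans (sum-incAt (decAt c i) j (subst (j <_) (sym (trans (length-decAt c i) l)) j<r)) (trans (sum-decAt c i 1≤) s))

-- A unit counts as often as there are positions from its own to the end of the list, so a move by
-- one position to the right lowers the weight by exactly one.
weight : List ℕ → ℕ
weight []       = 0
weight (x ∷ xs) = suc (length xs) ℕ.* x ℕ.+ weight xs

weight-move : ∀ c i → 1 ≤ nth c i → suc i < length c → suc (weight (incAt (decAt c i) (suc i))) ≡ weight c
weight-move (suc x ∷ y ∷ c) zero _ _ =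
  solve 4 (λ l x y w → con 1 :+ ((con 2 :+ l) :* x :+ ((con 1 :+ l) :* (con 1 :+ y) :+ w))
                    := (con 2 :+ l) :* (con 1 :+ x) :+ ((con 1 :+ l) :* y :+ w)) refl (length c) x y (weight c)
  where open ℕ-Solver
weight-move (suc x ∷ []) zero _ (s≤s ())
weight-move (x ∷ c) (suc i) 1≤ (s≤s i<l) = begin
  suc (suc (length (incAt (decAt c i) (suc i))) ℕ.* x ℕ.+ weight (incAt (decAt c i) (suc i)))
    ≡⟨ ℕₚ.+-suc _ _ ⟨
  suc (length (incAt (decAt c i) (suc i))) ℕ.* x ℕ.+ suc (weight (incAt (decAt c i) (suc i)))
    ≡⟨ cong₂ (λ l w → suc l ℕ.* x ℕ.+ w) (trans (length-incAt (decAt c i) (suc i)) (length-decAt c i)) (weight-move c i 1≤ i<l) ⟩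
  suc (length c) ℕ.* x ℕ.+ weight c ∎
  where open ≡-Reasoning

sum-ones : ∀ n → sum (replicate n 1) ≡ n
sum-ones zero    = refl
sum-ones (suc n) = cong suc (sum-ones n)

-- Pigeonhole: entries that are all at most 1 can reach a sum of at least the length only if all are
-- 1.
large-part : ∀ c → length c ≤ sum c → (∃ λ i → i < length c × 2 ≤ nth c i) ⊎ c ≡ replicate (length c) 1
large-part []                _ = inj₂ refl
large-part (suc (suc x) ∷ c) _ = inj₁ (0 , s≤s z≤n , s≤s (s≤s z≤n))
large-part (1 ∷ c) (s≤s le) with large-part c le
... | inj₁ (i , i<l , 2≤) = inj₁ (suc i , s≤s i<l , 2≤)
... | inj₂ eq             = inj₂ (cong (1 ∷_) eq)
large-part (0 ∷ c) le with large-part c (ℕₚ.≤-trans (ℕₚ.n≤1+n _) le)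
... | inj₁ (i , i<l , 2≤) = inj₁ (suc i , s≤s i<l , 2≤)
-- The head 0 leaves the tail a sum exceeding its length, which a list of ones does not have.
... | inj₂ eq             = contradiction le (ℕₚ.<⇒≱ (s≤s (ℕₚ.≤-reflexive (trans (cong sum eq) (sum-ones (length c))))))

-- A finite list over which a maximiser can be taken. Positive heads arise by incrementing the head
-- of a composition of the preceding sum, which keeps the recursion structural.
compositions : ℕ → ℕ → List (List ℕ)
compositions zero    zero    = [] ∷ []
compositions zero    (suc s) = []
compositions (suc n) zero    = map (0 ∷_) (compositions n 0)
compositions (suc n) (suc s) = map (0 ∷_) (compositions n (suc s)) ++ map (λ c → incAt c 0) (compositions (suc n) s)

compositions-sound : ∀ n s → All (λ c → length c ≡ n × sum c ≡ s) (compositions n s)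
compositions-sound zero    zero    = (refl , refl) ∷ []
compositions-sound zero    (suc s) = []
compositions-sound (suc n) zero    = Allₚ.map⁺ (All.map (λ (l , s) → cong suc l , s) (compositions-sound n 0))
compositions-sound (suc n) (suc s) = Allₚ.++⁺
  (Allₚ.map⁺ (All.map (λ (l , s) → cong suc l , s) (compositions-sound n (suc s))))
  (Allₚ.map⁺ (All.map (λ {c} → inc c) (compositions-sound (suc n) s)))
  where
  inc : ∀ c → length c ≡ suc n × sum c ≡ s → length (incAt c 0) ≡ suc n × sum (incAt c 0) ≡ suc s
  inc (x ∷ c) (l , s) = l , cong suc s

compositions-complete : ∀ c → c ∈ˡ compositions (length c) (sum c)
compositions-complete []          = here refl
compositions-complete (zero ∷ c) with sum c | compositions-complete c
... | zero  | c∈ = ∈-map⁺ (0 ∷_) c∈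
... | suc s | c∈ = ∈-++⁺ˡ (∈-map⁺ (0 ∷_) c∈)
compositions-complete (suc x ∷ c) = ∈-++⁺ʳ (map (0 ∷_) (compositions (length c) (suc (x ℕ.+ sum c)))) (∈-map⁺ (λ c → incAt c 0) (compositions-complete (x ∷ c)))

ℕtoℚ-nonNeg : ∀ n → ℚ.NonNegative (ℕtoℚ n)
ℕtoℚ-nonNeg n = ℚₚ.normalize-nonNeg n 1

<ℚ⇒≱ : ∀ {x y} → x ℚ.< y → ¬ (y ℚ.≤ x)
<ℚ⇒≱ x<y y≤x = ℚₚ.<-irrefl refl (ℚₚ.<-≤-trans x<y y≤x)

+ℚ-cancelˡ-≤ : ∀ p {x y} → p ℚ.+ x ℚ.≤ p ℚ.+ y → x ℚ.≤ y
+ℚ-cancelˡ-≤ p {x} {y} le = subst₂ ℚ._≤_ (cancel x) (cancel y) (ℚₚ.+-monoʳ-≤ (ℚ.- p) le)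
  where
  cancel : ∀ z → ℚ.- p ℚ.+ (p ℚ.+ z) ≡ z
  cancel z = trans (sym (ℚₚ.+-assoc (ℚ.- p) p z)) (trans (cong (ℚ._+ z) (ℚₚ.+-inverseˡ p)) (ℚₚ.+-identityˡ z))

rightTerm-cases : ∀ {r} (b : List ℕ → ℚ) c i →
  (suc i < r × rightTerm r b c i ≡ b (incAt (decAt c i) (suc i))) ⊎
  (¬ (suc i < r) × rightTerm r b c i ≡ 0ℚ)
rightTerm-cases {r} b c i with suc i <? r
... | yes i<r = inj₁ (i<r , refl)
... | no  i≮r = inj₂ (i≮r , refl)

-- After division by `q + 1` the value at `c` is the mean of two neighbouring values with weights
-- proportional to `q` and 1, where 0 is taken beyond either end; hence the name.
Harmonic : ℕ → ℕ → (List ℕ → ℚ) → Set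
Harmonic q r b = ∀ c i → length c ≡ r → sum c ≡ r → i < r → 2 ≤ nth c i →
  ℕtoℚ (suc q) ℚ.* b c ≡ leftTerm q b c i ℚ.+ rightTerm r b c i

-- At a positive maximum both neighbours in the relation are maxima as well, so a unit can be moved
-- to the right for ever, although each such move decreases the weight.
module MaximumPrinciple {q r : ℕ} (b : List ℕ → ℚ) (harmonic : Harmonic q r b)
                        (base≤0 : b (replicate r 1) ℚ.≤ 0ℚ) where

  ones : Composition r (replicate r 1)
  ones = comp (length-replicate r) (sum-ones r)

  module _ {M : ℚ} (0<M : 0ℚ ℚ.< M) (bound : ∀ c → Composition r c → b c ℚ.≤ M) where

    leftTerm≤ : ∀ c i → Composition r c → i < r → 2 ≤ nth c i → leftTerm q b c i ℚ.≤ ℕtoℚ q ℚ.* M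
    -- The left term is 0 at the left end, and `0 < M` makes this an admissible value.
    leftTerm≤ c zero    isComp i<r 2≤ = subst (ℚ._≤ ℕtoℚ q ℚ.* M) (ℚₚ.*-zeroʳ (ℕtoℚ q))
      (ℚₚ.*-monoˡ-≤-nonNeg (ℕtoℚ q) {{ℕtoℚ-nonNeg q}} (ℚₚ.<⇒≤ 0<M))
    leftTerm≤ c (suc j) isComp i<r 2≤ = ℚₚ.*-monoˡ-≤-nonNeg (ℕtoℚ q) {{ℕtoℚ-nonNeg q}}
      (bound _ (move-composition (suc j) j isComp (ℕₚ.<⇒≤ 2≤) (ℕₚ.<⇒≤ i<r)))

    -- Of the total `(q + 1) M` the left neighbour supplies at most `q M`, so at least `M` remains
    -- for the right one.
    rightTerm≥ : ∀ c i → Composition r c → i < r → 2 ≤ nth c i → M ℚ.≤ b c → M ℚ.≤ rightTerm r b c i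
    rightTerm≥ c i isComp i<r 2≤ M≤ = +ℚ-cancelˡ-≤ (ℕtoℚ q ℚ.* M) (begin
      ℕtoℚ q ℚ.* M ℚ.+ M                        ≡⟨ ℚₚ.+-comm (ℕtoℚ q ℚ.* M) M ⟩
      M ℚ.+ ℕtoℚ q ℚ.* M                        ≡⟨ cong (ℚ._+ ℕtoℚ q ℚ.* M) (ℚₚ.*-identityˡ M) ⟨
      1ℚ ℚ.* M ℚ.+ ℕtoℚ q ℚ.* M                 ≡⟨ ℚₚ.*-distribʳ-+ M 1ℚ (ℕtoℚ q) ⟨
      (1ℚ ℚ.+ ℕtoℚ q) ℚ.* M                     ≡⟨ cong (ℚ._* M) (ℕtoℚ-+ 1 q) ⟨
      ℕtoℚ (suc q) ℚ.* M                        ≤⟨ ℚₚ.*-monoˡ-≤-nonNeg (ℕtoℚ (suc q)) {{ℕtoℚ-nonNeg (suc q)}} M≤ ⟩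
      ℕtoℚ (suc q) ℚ.* b c                      ≡⟨ harmonic c i (Composition.length≡ isComp) (Composition.sum≡ isComp) i<r 2≤ ⟩
      leftTerm q b c i ℚ.+ rightTerm r b c i    ≤⟨ ℚₚ.+-monoˡ-≤ (rightTerm r b c i) (leftTerm≤ c i isComp i<r 2≤) ⟩
      ℕtoℚ q ℚ.* M ℚ.+ rightTerm r b c i        ∎)
      where
      open ℚₚ.≤-Reasoning

    no-maximum : ∀ w c → weight c ≤ w → Composition r c → ¬ (M ℚ.≤ b c)
    no-maximum w c wc≤w isComp M≤ with large-part c (ℕₚ.≤-reflexive (trans (Composition.length≡ isComp) (sym (Composition.sum≡ isComp))))
    -- The composition of all ones has value at most 0, hence less than `M`.
    ... | inj₂ eq = <ℚ⇒≱ 0<M (ℚₚ.≤-trans M≤ (subst (λ c → b c ℚ.≤ 0ℚ) (sym (trans eq (cong (λ n → replicate n 1) (Composition.length≡ isComp)))) base≤0))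
    ... | inj₁ (i , i<l , 2≤) = continue (rightTerm-cases b c i)
      where
      M≤right : M ℚ.≤ rightTerm r b c i
      M≤right = rightTerm≥ c i isComp (subst (i <_) (Composition.length≡ isComp) i<l) 2≤ M≤
      -- The bound `w` on the weight is the decreasing argument of the recursion.
      descend : ∀ w → suc (weight (incAt (decAt c i) (suc i))) ≤ w → suc i < r → ¬ (M ℚ.≤ b (incAt (decAt c i) (suc i)))
      descend (suc w) (s≤s w≤) i<r = no-maximum w _ w≤ (move-composition i (suc i) isComp (ℕₚ.<⇒≤ 2≤) i<r)
      continue : _ → _
      -- At the right end the right term is 0 and cannot reach `M`.
      continue (inj₂ (_ , eq))   = <ℚ⇒≱ 0<M (subst (M ℚ.≤_) eq M≤right)
      continue (inj₁ (i<r , eq)) = descend w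
        (subst (_≤ w) (sym (weight-move c i (ℕₚ.<⇒≤ 2≤) (subst (suc i <_) (sym (Composition.length≡ isComp)) i<r))) wc≤w)
        i<r (subst (M ℚ.≤_) eq M≤right)

  maximizer : List ℕ
  maximizer = Extrema.argmax b (replicate r 1) (compositions r r)

  maximizer-composition : Composition r maximizer
  maximizer-composition = Extrema.argmax-all b {P = Composition r} ones (All.map (λ (l , s) → comp l s) (compositions-sound r r))

  ≤-maximum : ∀ c → Composition r c → b c ℚ.≤ b maximizer
  ≤-maximum c (comp l s) = All.lookup (Extrema.f[xs]≤f[argmax] {f = b} (replicate r 1) (compositions r r))
    (subst₂ (λ l s → c ∈ˡ compositions l s) l s (compositions-complete c))

  nonPositive : ∀ c → Composition r c → b c ℚ.≤ 0ℚ
  nonPositive c isComp with b maximizer ℚₚ.≤? 0ℚ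
  ... | yes M≤0 = ℚₚ.≤-trans (≤-maximum c isComp) M≤0
  ... | no  M≰0 = ⊥-elim (no-maximum (ℚₚ.≰⇒> M≰0) ≤-maximum _ maximizer ℕₚ.≤-refl maximizer-composition ℚₚ.≤-refl)

-- Used for the difference of two solutions and, with second coefficient 0, for the multiple of a
-- solution by a power of `q`.
harmonic-lin : ∀ {q r} (x y : ℚ) {a b : List ℕ → ℚ} → Harmonic q r a → Harmonic q r b →
               Harmonic q r (λ c → x ℚ.* a c ℚ.+ y ℚ.* b c)
harmonic-lin {q} {r} x y {a} {b} ha hb c i l s i<r 2≤ = begin
  Q ℚ.* (x ℚ.* a c ℚ.+ y ℚ.* b c)                            ≡⟨ solve 5 (λ Q x y a b → Q :* (x :* a :+ y :* b) := x :* (Q :* a) :+ y :* (Q :* b)) refl Q x y (a c) (b c) ⟩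
  x ℚ.* (Q ℚ.* a c) ℚ.+ y ℚ.* (Q ℚ.* b c)                    ≡⟨ cong₂ (λ u v → x ℚ.* u ℚ.+ y ℚ.* v) (ha c i l s i<r 2≤) (hb c i l s i<r 2≤) ⟩
  x ℚ.* (leftTerm q a c i ℚ.+ rightTerm r a c i) ℚ.+ y ℚ.* (leftTerm q b c i ℚ.+ rightTerm r b c i)
    ≡⟨ solve 6 (λ x y l r l′ r′ → x :* (l :+ r) :+ y :* (l′ :+ r′) := (x :* l :+ y :* l′) :+ (x :* r :+ y :* r′)) refl x y (leftTerm q a c i) (rightTerm r a c i) (leftTerm q b c i) (rightTerm r b c i) ⟩
  (x ℚ.* leftTerm q a c i ℚ.+ y ℚ.* leftTerm q b c i) ℚ.+ (x ℚ.* rightTerm r a c i ℚ.+ y ℚ.* rightTerm r b c i)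
    ≡⟨ cong₂ ℚ._+_ (left i) right ⟩
  leftTerm q _ c i ℚ.+ rightTerm r _ c i ∎
  where
  open ≡-Reasoning
  open ℚ-Solver
  Q = ℕtoℚ (suc q)
  left : ∀ i → x ℚ.* leftTerm q a c i ℚ.+ y ℚ.* leftTerm q b c i ≡ leftTerm q (λ c → x ℚ.* a c ℚ.+ y ℚ.* b c) c i
  left zero    = solve 2 (λ x y → x :* con 0ℚ :+ y :* con 0ℚ := con 0ℚ) refl x y
  left (suc j) = solve 5 (λ q x y a b → x :* (q :* a) :+ y :* (q :* b) := q :* (x :* a :+ y :* b)) refl (ℕtoℚ q) x y (a (incAt (decAt c (suc j)) j)) (b (incAt (decAt c (suc j)) j))
  right : x ℚ.* rightTerm r a c i ℚ.+ y ℚ.* rightTerm r b c i ≡ rightTerm r (λ c → x ℚ.* a c ℚ.+ y ℚ.* b c) c i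
  right with suc i <? r
  ... | yes _ = refl
  ... | no  _ = solve 2 (λ x y → x :* con 0ℚ :+ y :* con 0ℚ := con 0ℚ) refl x y

-- The difference of `a` and `b` is harmonic and vanishes at all ones, so the maximum principle
-- makes it nonpositive. Exchanging `a` and `b` then gives equality.
difference-sign : ∀ {q r} {a b : List ℕ → ℚ} → Harmonic q r a → Harmonic q r b →
  a (replicate r 1) ≡ b (replicate r 1) → ∀ c → Composition r c → a c ℚ.≤ b c
difference-sign {q} {r} {a} {b} ha hb base c isComp = +ℚ-cancelˡ-≤ (ℚ.- b c) (begin
  ℚ.- b c ℚ.+ a c                        ≡⟨ solve 2 (λ a b → :- b :+ a := con 1ℚ :* a :+ con (ℚ.- 1ℚ) :* b) refl (a c) (b c) ⟩
  1ℚ ℚ.* a c ℚ.+ (ℚ.- 1ℚ) ℚ.* b c        ≤⟨ MaximumPrinciple.nonPositive _ (harmonic-lin 1ℚ (ℚ.- 1ℚ) ha hb) (ℚₚ.≤-reflexive base′) c isComp ⟩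
  0ℚ                                     ≡⟨ ℚₚ.+-inverseˡ (b c) ⟨
  ℚ.- b c ℚ.+ b c                        ∎)
  where
  open ℚₚ.≤-Reasoning
  open ℚ-Solver
  base′ : 1ℚ ℚ.* a (replicate r 1) ℚ.+ (ℚ.- 1ℚ) ℚ.* b (replicate r 1) ≡ 0ℚ
  base′ = trans (cong (λ z → 1ℚ ℚ.* z ℚ.+ (ℚ.- 1ℚ) ℚ.* b (replicate r 1)) base)
                (solve 1 (λ b → con 1ℚ :* b :+ con (ℚ.- 1ℚ) :* b := con 0ℚ) refl (b (replicate r 1)))

harmonic-unique : ∀ {q r} {a b : List ℕ → ℚ} → Harmonic q r a → Harmonic q r b →
  a (replicate r 1) ≡ b (replicate r 1) → ∀ c → Composition r c → a c ≡ b c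
harmonic-unique ha hb base c isComp = ℚₚ.≤-antisym (difference-sign ha hb base c isComp) (difference-sign hb ha (sym base) c isComp)

-- Chow functionals

-- The exponent vector is written out as a list of factors, so that reordering a product of classes
-- becomes a permutation of lists.
indices : ℕ → ℕ → List ℕ → List ℕ
indices q i []       = []
indices q i (c ∷ cs) = replicate c (qint q i) ++ indices q (suc i) cs

length-indices : ∀ q i cs → length (indices q i cs) ≡ sum cs
length-indices q i []       = refl
length-indices q i (c ∷ cs) = trans (length-++ (replicate c (qint q i)))
  (cong₂ ℕ._+_ (length-replicate c) (length-indices q (suc i) cs))

indices-incAt : ∀ q s c i → i < length c → indices q s (incAt c i) ↭ qint q (s ℕ.+ i) ∷ indices q s c
indices-incAt q s (x ∷ c) zero    _ rewrite ℕₚ.+-identityʳ s = ↭-refl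
indices-incAt q s (x ∷ c) (suc i) (s≤s i<l) rewrite ℕₚ.+-suc s i =
  ↭-trans (++⁺ˡ (replicate x (qint q s)) (indices-incAt q (suc s) c i i<l))
          (shift (qint q (suc s ℕ.+ i)) (replicate x (qint q s)) (indices q (suc s) c))

indices-decAt : ∀ q s c i → 1 ≤ nth c i → indices q s c ↭ qint q (s ℕ.+ i) ∷ indices q s (decAt c i)
indices-decAt q s (suc x ∷ c) zero    _ rewrite ℕₚ.+-identityʳ s = ↭-refl
indices-decAt q s (x ∷ c)     (suc i) 1≤ rewrite ℕₚ.+-suc s i =
  ↭-trans (++⁺ˡ (replicate x (qint q s)) (indices-decAt q (suc s) c i 1≤))
          (shift (qint q (suc s ℕ.+ i)) (replicate x (qint q s)) (indices q (suc s) (decAt c i)))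

γ : ∀ N → ℕ → Subset N → ℚ
γ N k S = ℕtoℚ (∣ S ∣ ⊓ k) ℚ.- divℕ (k ℕ.* ∣ S ∣) N

Functional : ℕ → Set
Functional N = List (Subset N) → ℚ

module _ {N : ℕ} where

  evalP-++ : ∀ (f : Functional N) p p′ → evalP f (p ++ p′) ≡ evalP f p ℚ.+ evalP f p′
  evalP-++ f p p′ = ∑-++ p p′ _

  evalP-scale : ∀ (f : Functional N) c m (h : ℚ × List (Subset N) → ℚ × List (Subset N)) →
    (∀ c′ m′ → h (c′ , m′) ≡ (c ℚ.* c′ , m ++ m′)) → ∀ p →
    evalP f (map h p) ≡ c ℚ.* evalP (λ m′ → f (m ++ m′)) p
  evalP-scale f c m h eq []             = sym (ℚₚ.*-zeroʳ c)
  evalP-scale f c m h eq ((c′ , m′) ∷ p) = begin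
    evalP f (h (c′ , m′) ∷ map h p)                 ≡⟨ cong (λ t → evalP f (t ∷ map h p)) (eq c′ m′) ⟩
    c ℚ.* c′ ℚ.* f (m ++ m′) ℚ.+ evalP f (map h p)  ≡⟨ cong₂ ℚ._+_ (ℚₚ.*-assoc c c′ (f (m ++ m′))) (evalP-scale f c m h eq p) ⟩
    c ℚ.* (c′ ℚ.* f (m ++ m′)) ℚ.+ c ℚ.* evalP (λ m′ → f (m ++ m′)) p ≡⟨ ℚₚ.*-distribˡ-+ c _ _ ⟨
    c ℚ.* evalP (λ m′ → f (m ++ m′)) ((c′ , m′) ∷ p) ∎
    where open ≡-Reasoning

  evalP-*P : ∀ (f : Functional N) p p′ → evalP f (p *P p′) ≡ evalP (λ m → evalP (λ m′ → f (m ++ m′)) p′) p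
  evalP-*P f []            p′ = refl
  evalP-*P f ((c , m) ∷ p) p′ = trans (evalP-++ f (map _ p′) (p *P p′))
    (cong₂ ℚ._+_ (evalP-scale f c m _ (λ _ _ → refl) p′) (evalP-*P f p p′))

  evalP-gamma : ∀ (f : Functional N) k → evalP f (gamma N k) ≡ ∑ (allSubsets N) (λ S → γ N k S ℚ.* f (S ∷ []))
  evalP-gamma f k = cong sumℚ (sym (map-∘ (allSubsets N)))

  -- The transpose of multiplication by `γ_k`, that is, the functional sending `m` to the value of
  -- `f` at `γ_k m`.
  γ· : ℕ → Functional N → Functional N
  γ· k f m = ∑ (allSubsets N) (λ S → γ N k S ℚ.* f (S ∷ m))

  γ*· : List ℕ → Functional N → Functional N
  γ*· []       f = f
  γ*· (k ∷ ks) f = γ· k (γ*· ks f)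

  -- Follows the expansion of `evalP`: the subset chosen for the first factor stays at the front of
  -- the monomial. In `γ*·` later factors are put in front of it instead, so the two agree only up
  -- to symmetry.
  evalγ : List ℕ → Functional N → ℚ
  evalγ []       f = f []
  evalγ (k ∷ ks) f = ∑ (allSubsets N) (λ S → γ N k S ℚ.* evalγ ks (λ m → f (S ∷ m)))

  -- The assumption on `p` is made for all functionals because splitting off a factor replaces `f`
  -- by `λ m → f (S ∷ m)`.
  evalP-γ-power : ∀ k ks p → (∀ f → evalP f p ≡ evalγ ks f) → ∀ c f →
    evalP f ((gamma N k ^P c) *P p) ≡ evalγ (replicate c k ++ ks) f
  evalP-γ-power k ks p ih zero f = begin
    evalP f (onePoly *P p)  ≡⟨ evalP-*P f onePoly p ⟩
    1ℚ ℚ.* evalP f p ℚ.+ 0ℚ ≡⟨ trans (ℚₚ.+-identityʳ _) (ℚₚ.*-identityˡ _) ⟩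
    evalP f p               ≡⟨ ih f ⟩
    evalγ ks f              ∎
    where open ≡-Reasoning
  evalP-γ-power k ks p ih (suc c) f = begin
    evalP f ((gamma N k *P (gamma N k ^P c)) *P p)
      ≡⟨ evalP-*P f (gamma N k *P (gamma N k ^P c)) p ⟩
    evalP (λ m → evalP (λ m′ → f (m ++ m′)) p) (gamma N k *P (gamma N k ^P c))
      ≡⟨ evalP-*P _ (gamma N k) (gamma N k ^P c) ⟩
    evalP (λ m₁ → evalP (λ m₂ → evalP (λ m′ → f ((m₁ ++ m₂) ++ m′)) p) (gamma N k ^P c)) (gamma N k)
      ≡⟨ evalP-gamma _ k ⟩
    ∑ (allSubsets N) (λ S → γ N k S ℚ.* evalP (λ m₂ → evalP (λ m′ → f (S ∷ (m₂ ++ m′))) p) (gamma N k ^P c))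
      ≡⟨ ∑-cong (allSubsets N) (λ S → cong (γ N k S ℚ.*_) (trans (sym (evalP-*P (λ m → f (S ∷ m)) (gamma N k ^P c) p)) (evalP-γ-power k ks p ih c (λ m → f (S ∷ m))))) ⟩
    evalγ (k ∷ replicate c k ++ ks) f ∎
    where open ≡-Reasoning

  evalP-gammaMonoFrom : ∀ q i cs f → evalP f (gammaMonoFrom N q i cs) ≡ evalγ (indices q i cs) f
  evalP-gammaMonoFrom q i []       f = trans (ℚₚ.+-identityʳ _) (ℚₚ.*-identityˡ _)
  evalP-gammaMonoFrom q i (c ∷ cs) f =
    evalP-γ-power (qint q i) (indices q (suc i) cs) _ (evalP-gammaMonoFrom q (suc i) cs) c f

  -- The conditions on a degree map without the normalisation on flags and in arbitrary degree `d`,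
  -- so that they persist under contraction with a class.
  record ChowFunctional (Flat : Subset N → Set) (d : ℕ) (f : Functional N) : Set where
    field
      symmetric : ∀ m m′ → length m ≡ d → m ↭ m′ → f m ≡ f m′
      nonFlat   : ∀ S m → suc (length m) ≡ d → ¬ Flat S → f (S ∷ m) ≡ 0ℚ
      incomp    : ∀ S T m → suc (suc (length m)) ≡ d → ¬ (S ⊆ T) → ¬ (T ⊆ S) → f (S ∷ T ∷ m) ≡ 0ℚ
      linear    : ∀ (i j : Fin N) m → suc (length m) ≡ d →
                  ∑ (allSubsets N) (λ S → sel (lookup S i) (f (S ∷ m))) ≡ ∑ (allSubsets N) (λ S → sel (lookup S j) (f (S ∷ m)))

open ChowFunctional

module _ {N : ℕ} where

  sel-* : ∀ b x y → sel b (x ℚ.* y) ≡ x ℚ.* sel b y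
  sel-* inside  x y = refl
  sel-* outside x y = sym (ℚₚ.*-zeroʳ x)

  sel-∑ : ∀ {A : Set} b (xs : List A) (f : A → ℚ) → sel b (∑ xs f) ≡ ∑ xs (λ x → sel b (f x))
  sel-∑ inside  xs f = refl
  sel-∑ outside xs f = sym (∑-zero xs (λ _ → refl))

  ∑-γ-zero : ∀ k {g : Subset N → ℚ} → (∀ T → g T ≡ 0ℚ) → ∑ (allSubsets N) (λ T → γ N k T ℚ.* g T) ≡ 0ℚ
  ∑-γ-zero k g≡0 = ∑-zero (allSubsets N) (λ T → trans (cong (γ N k T ℚ.*_) (g≡0 T)) (ℚₚ.*-zeroʳ (γ N k T)))

  -- Both sides are the same iterated sum with the subsets entered in opposite orders, and symmetry
  -- of `D` carries `S` through `m′`. As symmetry is available in degree `d` only, `f` is compared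
  -- with `D` only on monomials of the right length.
  evalγ-γ* : ∀ {Flat d} {D : Functional N} → ChowFunctional Flat d D → ∀ ks m (f : Functional N) → length ks ℕ.+ length m ≡ d →
    (∀ m′ → length m′ ≡ length ks → f m′ ≡ D (m′ ++ m)) → evalγ ks f ≡ γ*· ks D m
  evalγ-γ* chow []       m f len eq = eq [] refl
  evalγ-γ* {D = D} chow (k ∷ ks) m f len eq = ∑-cong (allSubsets N) (λ S → cong (γ N k S ℚ.*_)
    (evalγ-γ* chow ks (S ∷ m) (λ m′ → f (S ∷ m′)) (trans (ℕₚ.+-suc (length ks) (length m)) len)
      (λ m′ len′ → trans (eq (S ∷ m′) (cong suc len′))
        (symmetric chow _ _ (trans (cong suc (trans (length-++ m′) (cong (ℕ._+ length m) len′))) len) (↭-sym (shift S m′ m))))))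

  module _ {Flat : Subset N → Set} where

    -- Each relation for `γ· k f` is a weighted sum over `T` of the same relation for `f` on the
    -- monomial enlarged by `T`; symmetry of `f` brings the subsets concerned back in front of `T`.
    γ·-chow : ∀ {d f} k → ChowFunctional Flat (suc d) f → ChowFunctional Flat d (γ· k f)
    γ·-chow k chow .symmetric m m′ len m↭m′ =
      ∑-cong (allSubsets N) (λ S → cong (γ N k S ℚ.*_) (chow .symmetric _ _ (cong suc len) (prep S m↭m′)))
    γ·-chow k chow .nonFlat S m len ¬flat = ∑-γ-zero k (λ T →
      trans (chow .symmetric _ _ (cong suc len) (swap T S ↭-refl)) (chow .nonFlat S (T ∷ m) (cong suc len) ¬flat))
    γ·-chow k chow .incomp S S′ m len S⊈S′ S′⊈S = ∑-γ-zero k (λ T →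
      trans (chow .symmetric _ _ (cong suc len) (↭-trans (swap T S ↭-refl) (prep S (swap T S′ ↭-refl))))
            (chow .incomp S S′ (T ∷ m) (cong suc len) S⊈S′ S′⊈S))
    γ·-chow {f = f} k chow .linear i j m len = trans (expand i) (trans (∑-cong (allSubsets N) (λ T → cong (γ N k T ℚ.*_) (chow .linear i j (T ∷ m) (cong suc len)))) (sym (expand j)))
      where
      open ≡-Reasoning
      expand : ∀ i → ∑ (allSubsets N) (λ S → sel (lookup S i) (γ· k f (S ∷ m))) ≡
                     ∑ (allSubsets N) (λ T → γ N k T ℚ.* ∑ (allSubsets N) (λ S → sel (lookup S i) (f (S ∷ T ∷ m))))
      expand i = begin
        ∑ (allSubsets N) (λ S → sel (lookup S i) (γ· k f (S ∷ m)))
          ≡⟨ ∑-cong (allSubsets N) (λ S → trans (sel-∑ (lookup S i) (allSubsets N) _) (∑-cong (allSubsets N) (λ T →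
               trans (sel-* (lookup S i) (γ N k T) (f (T ∷ S ∷ m))) (cong (λ z → γ N k T ℚ.* sel (lookup S i) z) (chow .symmetric _ _ (cong suc len) (swap T S ↭-refl)))))) ⟩
        ∑ (allSubsets N) (λ S → ∑ (allSubsets N) (λ T → γ N k T ℚ.* sel (lookup S i) (f (S ∷ T ∷ m))))
          ≡⟨ ∑-swap (allSubsets N) (allSubsets N) _ ⟩
        ∑ (allSubsets N) (λ T → ∑ (allSubsets N) (λ S → γ N k T ℚ.* sel (lookup S i) (f (S ∷ T ∷ m))))
          ≡⟨ ∑-cong (allSubsets N) (λ T → ∑-*ˡ (allSubsets N) (γ N k T) _) ⟩
        ∑ (allSubsets N) (λ T → γ N k T ℚ.* ∑ (allSubsets N) (λ S → sel (lookup S i) (f (S ∷ T ∷ m)))) ∎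

    γ*·-chow : ∀ {d f} ks e → ChowFunctional Flat d f → length ks ℕ.+ e ≡ d → ChowFunctional Flat e (γ*· ks f)
    γ*·-chow []       e chow refl = chow
    γ*·-chow (k ∷ ks) e chow len  = γ·-chow k (γ*·-chow ks (suc e) chow (trans (ℕₚ.+-suc (length ks) e) len))

    -- For a transposition of two classes the double sum is interchanged, and symmetry of the
    -- contracted functional exchanges the two chosen subsets.
    γ*·-perm : ∀ {d f ks ks′} → ChowFunctional Flat d f → ks ↭ ks′ → ∀ m → length ks ℕ.+ length m ≡ d →
               γ*· ks f m ≡ γ*· ks′ f m
    γ*·-perm chow ↭-refl m len = refl
    γ*·-perm {ks = k ∷ ks} chow (prep k p) m len = ∑-cong (allSubsets N) (λ S → cong (γ N k S ℚ.*_)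
      (γ*·-perm chow p (S ∷ m) (trans (ℕₚ.+-suc (length ks) (length m)) len)))
    γ*·-perm {f = f} {ks = k ∷ l ∷ ks} {ks′ = _ ∷ _ ∷ ks′} chow (swap k l p) m len = begin
      ∑ 𝒫 (λ S → γ N k S ℚ.* ∑ 𝒫 (λ T → γ N l T ℚ.* γ*· ks f (T ∷ S ∷ m)))
        ≡⟨ ∑-cong 𝒫 (λ S → trans (sym (∑-*ˡ 𝒫 (γ N k S) _)) (∑-cong 𝒫 (λ T → exchange (γ N k S) (γ N l T) (rearrange S T)))) ⟩
      ∑ 𝒫 (λ S → ∑ 𝒫 (λ T → γ N l T ℚ.* (γ N k S ℚ.* γ*· ks′ f (S ∷ T ∷ m))))
        ≡⟨ ∑-swap 𝒫 𝒫 _ ⟩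
      ∑ 𝒫 (λ T → ∑ 𝒫 (λ S → γ N l T ℚ.* (γ N k S ℚ.* γ*· ks′ f (S ∷ T ∷ m))))
        ≡⟨ ∑-cong 𝒫 (λ T → ∑-*ˡ 𝒫 (γ N l T) _) ⟩
      ∑ 𝒫 (λ T → γ N l T ℚ.* ∑ 𝒫 (λ S → γ N k S ℚ.* γ*· ks′ f (S ∷ T ∷ m))) ∎
      where
      open ≡-Reasoning
      𝒫 = allSubsets N
      len′ : length ks ℕ.+ suc (suc (length m)) ≡ _
      len′ = trans (trans (ℕₚ.+-suc (length ks) _) (cong suc (ℕₚ.+-suc (length ks) (length m)))) len
      rearrange : ∀ S T → γ*· ks f (T ∷ S ∷ m) ≡ γ*· ks′ f (S ∷ T ∷ m)
      rearrange S T = trans (γ*·-chow ks (suc (suc (length m))) chow len′ .symmetric _ _ refl (swap T S ↭-refl)) (γ*·-perm chow p (S ∷ T ∷ m) len′)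
      exchange : ∀ a b {x y} → x ≡ y → a ℚ.* (b ℚ.* x) ≡ b ℚ.* (a ℚ.* y)
      exchange a b {x} refl = solve 3 (λ a b x → a :* (b :* x) := b :* (a :* x)) refl a b x
        where open ℚ-Solver
    γ*·-perm chow (↭-trans p p′) m len = trans (γ*·-perm chow p m len)
      (γ*·-perm chow p′ m (trans (cong (ℕ._+ length m) (sym (↭-length p))) len))

-- Hypersimplex classes modulo the linear relations

γ-normal : ∀ {N} .{{_ : NonZero N}} k S → γ N k S ≡ ℕtoℚ (∣ S ∣ ⊓ k) ℚ.- divℕ 1 N ℚ.* ℕtoℚ (k ℕ.* ∣ S ∣)
γ-normal {N} k S = cong (λ z → ℕtoℚ (∣ S ∣ ⊓ k) ℚ.- z)
  (trans (cong (λ a → divℕ a N) (sym (ℕₚ.*-identityˡ (k ℕ.* ∣ S ∣)))) (divℕ-scale 1 (k ℕ.* ∣ S ∣) N))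

-- Together with `γ-top` this accounts for the zero terms at both ends of the remixed Eulerian
-- relation, since `qint q 0` is 0 and `qint q (suc r)` is the number of points.
γ-0 : ∀ {N} .{{_ : NonZero N}} (S : Subset N) → γ N 0 S ≡ 0ℚ
γ-0 {N} S = begin
  γ N 0 S                                     ≡⟨ γ-normal 0 S ⟩
  ℕtoℚ (∣ S ∣ ⊓ 0) ℚ.- divℕ 1 N ℚ.* ℕtoℚ 0    ≡⟨ cong (λ z → ℕtoℚ z ℚ.- divℕ 1 N ℚ.* 0ℚ) (ℕₚ.⊓-zeroʳ ∣ S ∣) ⟩
  0ℚ ℚ.- divℕ 1 N ℚ.* 0ℚ                      ≡⟨ solve 1 (λ d → con 0ℚ :- d :* con 0ℚ := con 0ℚ) refl (divℕ 1 N) ⟩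
  0ℚ                                          ∎
  where
  open ≡-Reasoning
  open ℚ-Solver

γ-top : ∀ {N} .{{_ : NonZero N}} (S : Subset N) → γ N N S ≡ 0ℚ
γ-top {N} S = begin
  γ N N S                                                  ≡⟨ γ-normal N S ⟩
  ℕtoℚ (∣ S ∣ ⊓ N) ℚ.- divℕ 1 N ℚ.* ℕtoℚ (N ℕ.* ∣ S ∣)     ≡⟨ cong₂ (λ x y → ℕtoℚ x ℚ.- divℕ 1 N ℚ.* y) (ℕₚ.m≤n⇒m⊓n≡m (∣p∣≤n S)) (ℕtoℚ-* N ∣ S ∣) ⟩
  ℕtoℚ (∣ S ∣) ℚ.- divℕ 1 N ℚ.* (ℕtoℚ N ℚ.* ℕtoℚ (∣ S ∣))      ≡⟨ solve 3 (λ s d n → s :- d :* (n :* s) := s :- (d :* n) :* s) refl (ℕtoℚ (∣ S ∣)) (divℕ 1 N) (ℕtoℚ N) ⟩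
  ℕtoℚ (∣ S ∣) ℚ.- (divℕ 1 N ℚ.* ℕtoℚ N) ℚ.* ℕtoℚ (∣ S ∣)      ≡⟨ cong (λ z → ℕtoℚ (∣ S ∣) ℚ.- z ℚ.* ℕtoℚ (∣ S ∣)) (divℕ-* 1 N) ⟩
  ℕtoℚ (∣ S ∣) ℚ.- 1ℚ ℚ.* ℕtoℚ (∣ S ∣)                         ≡⟨ solve 1 (λ s → s :- con 1ℚ :* s := con 0ℚ) refl (ℕtoℚ (∣ S ∣)) ⟩
  0ℚ                                                       ∎
  where
  open ≡-Reasoning
  open ℚ-Solver

γ·-zero : ∀ {N k} (f : Functional N) m → (∀ S → γ N k S ≡ 0ℚ) → γ· k f m ≡ 0ℚ
γ·-zero {N} f m γ≡0 = ∑-zero (allSubsets N) (λ S → trans (cong (ℚ._* f (S ∷ m)) (γ≡0 S)) (ℚₚ.*-zeroˡ (f (S ∷ m))))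

*-vanish : ∀ {x} a b → x ≡ 0ℚ → a ℚ.* x ≡ b ℚ.* x
*-vanish a b refl = trans (ℚₚ.*-zeroʳ a) (sym (ℚₚ.*-zeroʳ b))

module _ {N : ℕ} {Flat : Subset N → Set} where

  -- Flatness need not be decidable, but equality of rationals is stable under double negation.
  by-flatness : ∀ {d f} → ChowFunctional Flat (suc d) f → ∀ S m → length m ≡ d → {u v : ℚ} →
    (f (S ∷ m) ≡ 0ℚ → u ≡ v) → (Flat S → u ≡ v) → u ≡ v
  by-flatness chow S m len {u} {v} vanish flat =
    decidable-stable (u ℚₚ.≟ v) (λ u≢v → u≢v (vanish (chow .nonFlat S m (cong suc len) (u≢v ∘ flat))))

  comparable-case : ∀ {d f} → ChowFunctional Flat (suc (suc d)) f → ∀ S F m → length m ≡ d → {P : Set} →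
    (f (S ∷ F ∷ m) ≡ 0ℚ → P) → (S ⊆ F → P) → (F ⊆ S → P) → P
  comparable-case chow S F m len vanish below above with S ⊆? F | F ⊆? S
  ... | yes S⊆F | _       = below S⊆F
  ... | no  _   | yes F⊆S = above F⊆S
  ... | no  S⊈F | no  F⊈S = vanish (chow .incomp S F m (cong (λ n → suc (suc n)) len) S⊈F F⊈S)

  -- Modulo the linear relations γ_k may be represented with any linear function S ↦ |S ∩ U|, up to a multiple of the
  -- hyperplane class, provided that it agrees with min(|S|, k) wherever f does not vanish.
  γ·-linear : .{{_ : NonZero N}} → ∀ {d f} → ChowFunctional Flat (suc d) f → ∀ k U m → length m ≡ d → (i : Fin N) →
    (∀ S → ℕtoℚ (∣ S ∣ ⊓ k) ℚ.* f (S ∷ m) ≡ ℕtoℚ (∣ S ∩ U ∣) ℚ.* f (S ∷ m)) →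
    γ· k f m ≡ (ℕtoℚ (∣ U ∣) ℚ.- ℕtoℚ k) ℚ.* ∑ (allSubsets N) (λ S → sel (lookup S i) (f (S ∷ m)))
  γ·-linear {f = f} chow k U m len i agree = begin
    ∑ 𝒫 (λ S → γ N k S ℚ.* f (S ∷ m))
      ≡⟨ ∑-cong 𝒫 termwise ⟩
    ∑ 𝒫 (λ S → ℕtoℚ (∣ S ∩ U ∣) ℚ.* f (S ∷ m) ℚ.+ ℚ.- (δ ℚ.* ℕtoℚ k) ℚ.* (ℕtoℚ (∣ S ∩ ⊤ ∣) ℚ.* f (S ∷ m)))
      ≡⟨ ∑-+ 𝒫 (λ S → ℕtoℚ (∣ S ∩ U ∣) ℚ.* f (S ∷ m)) (λ S → ℚ.- (δ ℚ.* ℕtoℚ k) ℚ.* (ℕtoℚ (∣ S ∩ ⊤ ∣) ℚ.* f (S ∷ m))) ⟩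
    ∑ 𝒫 (λ S → ℕtoℚ (∣ S ∩ U ∣) ℚ.* f (S ∷ m)) ℚ.+ ∑ 𝒫 (λ S → ℚ.- (δ ℚ.* ℕtoℚ k) ℚ.* (ℕtoℚ (∣ S ∩ ⊤ ∣) ℚ.* f (S ∷ m)))
      ≡⟨ cong₂ ℚ._+_ (weighted U) (trans (∑-*ˡ 𝒫 (ℚ.- (δ ℚ.* ℕtoℚ k)) (λ S → ℕtoℚ (∣ S ∩ ⊤ ∣) ℚ.* f (S ∷ m))) (cong (ℚ.- (δ ℚ.* ℕtoℚ k) ℚ.*_) (weighted ⊤))) ⟩
    ℕtoℚ (∣ U ∣) ℚ.* α ℚ.+ ℚ.- (δ ℚ.* ℕtoℚ k) ℚ.* (ℕtoℚ (∣ ⊤ {N} ∣) ℚ.* α)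
      ≡⟨ cong (λ n → ℕtoℚ (∣ U ∣) ℚ.* α ℚ.+ ℚ.- (δ ℚ.* ℕtoℚ k) ℚ.* (ℕtoℚ n ℚ.* α)) (∣⊤∣≡n N) ⟩
    ℕtoℚ (∣ U ∣) ℚ.* α ℚ.+ ℚ.- (δ ℚ.* ℕtoℚ k) ℚ.* (ℕtoℚ N ℚ.* α)
      ≡⟨ solve 5 (λ u a d k n → u :* a :+ :- (d :* k) :* (n :* a) := (u :- (d :* n) :* k) :* a) refl (ℕtoℚ (∣ U ∣)) α δ (ℕtoℚ k) (ℕtoℚ N) ⟩
    (ℕtoℚ (∣ U ∣) ℚ.- (δ ℚ.* ℕtoℚ N) ℚ.* ℕtoℚ k) ℚ.* α
      ≡⟨ cong (λ z → (ℕtoℚ (∣ U ∣) ℚ.- z) ℚ.* α) (trans (cong (ℚ._* ℕtoℚ k) (divℕ-* 1 N)) (ℚₚ.*-identityˡ (ℕtoℚ k))) ⟩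
    (ℕtoℚ (∣ U ∣) ℚ.- ℕtoℚ k) ℚ.* α ∎
    where
    open ≡-Reasoning
    open ℚ-Solver
    𝒫 = allSubsets N
    δ = divℕ 1 N
    α = ∑ 𝒫 (λ S → sel (lookup S i) (f (S ∷ m)))
    weighted : ∀ U → ∑ 𝒫 (λ S → ℕtoℚ (∣ S ∩ U ∣) ℚ.* f (S ∷ m)) ≡ ℕtoℚ (∣ U ∣) ℚ.* α
    weighted U = ∑-∣∩∣ U 𝒫 (λ S → S) (λ S → f (S ∷ m)) α (λ j → chow .linear j i m (cong suc len))
    termwise : ∀ S → γ N k S ℚ.* f (S ∷ m) ≡ ℕtoℚ (∣ S ∩ U ∣) ℚ.* f (S ∷ m) ℚ.+ ℚ.- (δ ℚ.* ℕtoℚ k) ℚ.* (ℕtoℚ (∣ S ∩ ⊤ ∣) ℚ.* f (S ∷ m))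
    termwise S = begin
      γ N k S ℚ.* f (S ∷ m)
        ≡⟨ cong (ℚ._* f (S ∷ m)) (trans (γ-normal k S) (cong (λ z → ℕtoℚ (∣ S ∣ ⊓ k) ℚ.- δ ℚ.* z) (ℕtoℚ-* k ∣ S ∣))) ⟩
      (ℕtoℚ (∣ S ∣ ⊓ k) ℚ.- δ ℚ.* (ℕtoℚ k ℚ.* ℕtoℚ (∣ S ∣))) ℚ.* f (S ∷ m)
        ≡⟨ solve 5 (λ a d k s y → (a :- d :* (k :* s)) :* y := a :* y :+ :- (d :* k) :* (s :* y)) refl (ℕtoℚ (∣ S ∣ ⊓ k)) δ (ℕtoℚ k) (ℕtoℚ (∣ S ∣)) (f (S ∷ m)) ⟩
      ℕtoℚ (∣ S ∣ ⊓ k) ℚ.* f (S ∷ m) ℚ.+ ℚ.- (δ ℚ.* ℕtoℚ k) ℚ.* (ℕtoℚ (∣ S ∣) ℚ.* f (S ∷ m))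
        ≡⟨ cong₂ (λ x n → x ℚ.+ ℚ.- (δ ℚ.* ℕtoℚ k) ℚ.* (ℕtoℚ n ℚ.* f (S ∷ m))) (agree S) (cong ∣_∣ (sym (∩-identityʳ S))) ⟩
      ℕtoℚ (∣ S ∩ U ∣) ℚ.* f (S ∷ m) ℚ.+ ℚ.- (δ ℚ.* ℕtoℚ k) ℚ.* (ℕtoℚ (∣ S ∩ ⊤ ∣) ℚ.* f (S ∷ m)) ∎

  -- Take `U = F` in `γ·-linear`: the minimum of `|S|` and `|F|` equals `|S ∩ F|` when `S` and `F`
  -- are comparable, `f` vanishes when they are not, and the factor `|U| - k` is 0.
  γ·-kill : .{{_ : NonZero N}} → Fin N → ∀ {d f} → ChowFunctional Flat (suc (suc d)) f → ∀ F m → length m ≡ d →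
            γ· ∣ F ∣ f (F ∷ m) ≡ 0ℚ
  γ·-kill i {f = f} chow F m len = begin
    γ· ∣ F ∣ f (F ∷ m) ≡⟨ γ·-linear chow ∣ F ∣ F (F ∷ m) (cong suc len) i (λ S → comparable-case chow S F m len
        (*-vanish (ℕtoℚ (∣ S ∣ ⊓ ∣ F ∣)) (ℕtoℚ (∣ S ∩ F ∣)))
        (λ S⊆F → cong (λ n → ℕtoℚ n ℚ.* f (S ∷ F ∷ m)) (trans (ℕₚ.m≤n⇒m⊓n≡m (p⊆q⇒∣p∣≤∣q∣ S⊆F)) (cong ∣_∣ (sym (⊆-antisym (p∩q⊆p S F) (λ x∈S → x∈p∩q⁺ (x∈S , S⊆F x∈S)))))))
        (λ F⊆S → cong (λ n → ℕtoℚ n ℚ.* f (S ∷ F ∷ m)) (trans (ℕₚ.m≥n⇒m⊓n≡n (p⊆q⇒∣p∣≤∣q∣ F⊆S)) (cong ∣_∣ (sym (⊆-antisym (p∩q⊆q S F) (λ x∈F → x∈p∩q⁺ (F⊆S x∈F , x∈F)))))))) ⟩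
    (ℕtoℚ (∣ F ∣) ℚ.- ℕtoℚ (∣ F ∣)) ℚ.* α ≡⟨ cong (ℚ._* α) (ℚₚ.+-inverseʳ (ℕtoℚ (∣ F ∣))) ⟩
    0ℚ ℚ.* α ≡⟨ ℚₚ.*-zeroˡ α ⟩
    0ℚ ∎
    where
    open ≡-Reasoning
    α = ∑ (allSubsets N) (λ S → sel (lookup S i) (f (S ∷ F ∷ m)))

  -- The matching class may stand anywhere in `ks`: the classes before it only add subsets `T` to
  -- the monomial, and symmetry returns `F` to the front.
  γ*·-kill : .{{_ : NonZero N}} → Fin N → ∀ {d f} → ChowFunctional Flat d f → ∀ ks F m → ∣ F ∣ ∈ˡ ks →
             length ks ℕ.+ suc (length m) ≡ d → γ*· ks f (F ∷ m) ≡ 0ℚ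
  γ*·-kill i chow (_ ∷ ks) F m (here refl) len =
    γ·-kill i (γ*·-chow ks _ chow (trans (ℕₚ.+-suc (length ks) (suc (length m))) len)) F m refl
  γ*·-kill i chow (k ∷ ks) F m (there ∈ks) len = ∑-γ-zero k (λ T →
    trans (γ*·-chow ks _ chow len′ .symmetric _ _ refl (swap T F ↭-refl)) (γ*·-kill i chow ks F (T ∷ m) ∈ks len′))
    where len′ = trans (ℕₚ.+-suc (length ks) (suc (length m))) len

-- Arithmetic of q-integers

qint-mono-≤ : ∀ q {s t} → s ≤ t → qint q s ≤ qint q t
qint-mono-≤ q s≤t = go (ℕₚ.≤⇒≤′ s≤t)
  where
  go : ∀ {s t} → s ℕ.≤′ t → qint q s ≤ qint q t
  go ℕ.≤′-refl             = ℕₚ.≤-refl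
  go (ℕ.≤′-step {t} s≤′t)  = ℕₚ.≤-trans (go s≤′t) (ℕₚ.m≤n+m (qint q t) (q ^ t))

qint-mono-< : ∀ q .{{_ : NonZero q}} {s t} → s < t → qint q s < qint q t
qint-mono-< q {s} s<t = ℕₚ.≤-trans (ℕₚ.+-monoˡ-≤ (qint q s) (ℕₚ.m^n>0 q s)) (qint-mono-≤ q s<t)

qint-cancel-< : ∀ q {s t} → qint q s < qint q t → s < t
qint-cancel-< q lt = ℕₚ.≰⇒> (λ t≤s → ℕₚ.<⇒≱ lt (qint-mono-≤ q t≤s))

-- The definition adds the highest power of `q`; this form, which adds the constant term, matches
-- the size `q |F| + 1` of a join.
qint-suc : ∀ q t → qint q (suc t) ≡ suc (q ℕ.* qint q t)
qint-suc q zero    = cong suc (sym (ℕₚ.*-zeroʳ q))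
qint-suc q (suc t) = begin
  q ℕ.* q ^ t ℕ.+ qint q (suc t)           ≡⟨ cong (q ℕ.* q ^ t ℕ.+_) (qint-suc q t) ⟩
  q ℕ.* q ^ t ℕ.+ suc (q ℕ.* qint q t)     ≡⟨ ℕₚ.+-suc (q ℕ.* q ^ t) (q ℕ.* qint q t) ⟩
  suc (q ℕ.* q ^ t ℕ.+ q ℕ.* qint q t)     ≡⟨ cong suc (ℕₚ.*-distribˡ-+ q (q ^ t) (qint q t)) ⟨
  suc (q ℕ.* qint q (suc t))               ∎
  where open ≡-Reasoning

qint-+ : ∀ q s t → qint q (s ℕ.+ t) ≡ qint q s ℕ.+ q ^ s ℕ.* qint q t
qint-+ q s zero = begin
  qint q (s ℕ.+ 0)             ≡⟨ cong (qint q) (ℕₚ.+-identityʳ s) ⟩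
  qint q s                     ≡⟨ ℕₚ.+-identityʳ (qint q s) ⟨
  qint q s ℕ.+ 0               ≡⟨ cong (qint q s ℕ.+_) (ℕₚ.*-zeroʳ (q ^ s)) ⟨
  qint q s ℕ.+ q ^ s ℕ.* 0     ∎
  where open ≡-Reasoning
qint-+ q s (suc t) = begin
  qint q (s ℕ.+ suc t)                                       ≡⟨ cong (qint q) (ℕₚ.+-suc s t) ⟩
  q ^ (s ℕ.+ t) ℕ.+ qint q (s ℕ.+ t)                         ≡⟨ cong₂ ℕ._+_ (ℕₚ.^-distribˡ-+-* q s t) (qint-+ q s t) ⟩
  q ^ s ℕ.* q ^ t ℕ.+ (qint q s ℕ.+ q ^ s ℕ.* qint q t)      ≡⟨ solve 4 (λ a b c d → a :* b :+ (c :+ a :* d) := c :+ a :* (b :+ d)) refl (q ^ s) (q ^ t) (qint q s) (qint q t) ⟩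
  qint q s ℕ.+ q ^ s ℕ.* qint q (suc t)                      ∎
  where
  open ≡-Reasoning
  open ℕ-Solver

-- The two successive differences are `q ^ i` and `q ^ suc i`, so `q` times the first is the second.
qint-second-difference : ∀ q i → suc q ℕ.* qint q (suc i) ≡ q ℕ.* qint q i ℕ.+ qint q (suc (suc i))
qint-second-difference q i = solve 3 (λ q p x → (con 1 :+ q) :* (p :+ x) := q :* x :+ (q :* p :+ (p :+ x))) refl q (q ^ i) (qint q i)
  where open ℕ-Solver

-- As a function of `k`, the minimum of `qint q t` and `qint q k` is `qint q k` up to `k = t` and
-- constant from there on. Both pieces satisfy the relation, which can therefore fail only when the
-- break is at the middle index `suc i`.
⊓-qint-second-difference : ∀ q i t → t ≢ suc i →
  suc q ℕ.* (qint q t ⊓ qint q (suc i)) ≡ q ℕ.* (qint q t ⊓ qint q i) ℕ.+ qint q t ⊓ qint q (suc (suc i))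
⊓-qint-second-difference q i t t≢ with ℕₚ.<-cmp t (suc i)
... | tri≈ _ t≡ _ = contradiction t≡ t≢
... | tri< (s≤s t≤i) _ _
  rewrite ℕₚ.m≤n⇒m⊓n≡m (qint-mono-≤ q t≤i)
        | ℕₚ.m≤n⇒m⊓n≡m (qint-mono-≤ q (ℕₚ.m≤n⇒m≤1+n t≤i))
        | ℕₚ.m≤n⇒m⊓n≡m (qint-mono-≤ q (ℕₚ.m≤n⇒m≤1+n (ℕₚ.m≤n⇒m≤1+n t≤i))) = ℕₚ.+-comm (qint q t) (q ℕ.* qint q t)
... | tri> _ _ i<t
  rewrite ℕₚ.m≥n⇒m⊓n≡n (qint-mono-≤ q i<t)
        | ℕₚ.m≥n⇒m⊓n≡n (qint-mono-≤ q (ℕₚ.<⇒≤ i<t))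
        | ℕₚ.m≥n⇒m⊓n≡n (qint-mono-≤ q (ℕₚ.≤-trans (ℕₚ.n≤1+n i) (ℕₚ.<⇒≤ i<t))) = qint-second-difference q i

γ-second-difference : ∀ {N} .{{_ : NonZero N}} q i t (S : Subset N) → ∣ S ∣ ≡ qint q t → t ≢ suc i →
  ℕtoℚ (suc q) ℚ.* γ N (qint q (suc i)) S ≡ ℕtoℚ q ℚ.* γ N (qint q i) S ℚ.+ γ N (qint q (suc (suc i))) S
γ-second-difference {N} q i t S ∣S∣≡ t≢ = begin
  Q ℚ.* γ N (qint q (suc i)) S                                  ≡⟨ cong (Q ℚ.*_) (γ-normal (qint q (suc i)) S) ⟩
  Q ℚ.* (A (suc i) ℚ.- δ ℚ.* X (suc i))                         ≡⟨ solve 4 (λ Q a d x → Q :* (a :- d :* x) := Q :* a :- d :* (Q :* x)) refl Q (A (suc i)) δ (X (suc i)) ⟩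
  Q ℚ.* A (suc i) ℚ.- δ ℚ.* (Q ℚ.* X (suc i))                   ≡⟨ cong₂ (λ u v → u ℚ.- δ ℚ.* v) (transfer _ _ _ minima) (transfer _ _ _ products) ⟩
  (ℕtoℚ q ℚ.* A i ℚ.+ A (suc (suc i))) ℚ.- δ ℚ.* (ℕtoℚ q ℚ.* X i ℚ.+ X (suc (suc i)))
    ≡⟨ solve 6 (λ q a a′ d x x′ → (q :* a :+ a′) :- d :* (q :* x :+ x′) := q :* (a :- d :* x) :+ (a′ :- d :* x′)) refl (ℕtoℚ q) (A i) (A (suc (suc i))) δ (X i) (X (suc (suc i))) ⟩
  ℕtoℚ q ℚ.* (A i ℚ.- δ ℚ.* X i) ℚ.+ (A (suc (suc i)) ℚ.- δ ℚ.* X (suc (suc i)))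
    ≡⟨ cong₂ (λ u v → ℕtoℚ q ℚ.* u ℚ.+ v) (γ-normal (qint q i) S) (γ-normal (qint q (suc (suc i))) S) ⟨
  ℕtoℚ q ℚ.* γ N (qint q i) S ℚ.+ γ N (qint q (suc (suc i))) S  ∎
  where
  open ≡-Reasoning
  open ℚ-Solver
  Q = ℕtoℚ (suc q)
  δ = divℕ 1 N
  A X : ℕ → ℚ
  A k = ℕtoℚ (∣ S ∣ ⊓ qint q k)
  X k = ℕtoℚ (qint q k ℕ.* ∣ S ∣)
  transfer : ∀ x y z → suc q ℕ.* x ≡ q ℕ.* y ℕ.+ z → ℕtoℚ (suc q) ℚ.* ℕtoℚ x ≡ ℕtoℚ q ℚ.* ℕtoℚ y ℚ.+ ℕtoℚ z
  transfer x y z eq = trans (sym (ℕtoℚ-* (suc q) x)) (trans (cong ℕtoℚ eq)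
    (trans (ℕtoℚ-+ (q ℕ.* y) z) (cong (ℚ._+ ℕtoℚ z) (ℕtoℚ-* q y))))
  minima : suc q ℕ.* (∣ S ∣ ⊓ qint q (suc i)) ≡ q ℕ.* (∣ S ∣ ⊓ qint q i) ℕ.+ (∣ S ∣ ⊓ qint q (suc (suc i)))
  minima rewrite ∣S∣≡ = ⊓-qint-second-difference q i t t≢
  products : suc q ℕ.* (qint q (suc i) ℕ.* ∣ S ∣) ≡ q ℕ.* (qint q i ℕ.* ∣ S ∣) ℕ.+ qint q (suc (suc i)) ℕ.* ∣ S ∣
  products = begin
    suc q ℕ.* (qint q (suc i) ℕ.* ∣ S ∣)  ≡⟨ ℕₚ.*-assoc (suc q) (qint q (suc i)) ∣ S ∣ ⟨
    suc q ℕ.* qint q (suc i) ℕ.* ∣ S ∣    ≡⟨ cong (ℕ._* ∣ S ∣) (qint-second-difference q i) ⟩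
    (q ℕ.* qint q i ℕ.+ qint q (suc (suc i))) ℕ.* ∣ S ∣  ≡⟨ ℕₚ.*-distribʳ-+ ∣ S ∣ (q ℕ.* qint q i) (qint q (suc (suc i))) ⟩
    q ℕ.* qint q i ℕ.* ∣ S ∣ ℕ.+ qint q (suc (suc i)) ℕ.* ∣ S ∣ ≡⟨ cong (ℕ._+ qint q (suc (suc i)) ℕ.* ∣ S ∣) (ℕₚ.*-assoc q (qint q i) ∣ S ∣) ⟩
    q ℕ.* (qint q i ℕ.* ∣ S ∣) ℕ.+ qint q (suc (suc i)) ℕ.* ∣ S ∣ ∎

nth-decAt : ∀ c i → 2 ≤ nth c i → 1 ≤ nth (decAt c i) i
nth-decAt (suc (suc x) ∷ c) zero    _  = s≤s z≤n
nth-decAt (suc zero ∷ c)    zero    (s≤s ())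
nth-decAt (x ∷ c)           (suc i) 2≤ = nth-decAt c i 2≤

∈-indices-ones : ∀ q s j t → s ≤ t → t < s ℕ.+ j → qint q t ∈ˡ indices q s (replicate j 1)
∈-indices-ones q s zero    t s≤t t<s = contradiction s≤t (ℕₚ.<⇒≱ (subst (t <_) (ℕₚ.+-identityʳ s) t<s))
∈-indices-ones q s (suc j) t s≤t t<  with s ℕ.≟ t
... | yes refl = here refl
... | no  s≢t  = there (∈-indices-ones q (suc s) j t (ℕₚ.≤∧≢⇒< s≤t s≢t) (subst (t <_) (ℕₚ.+-suc s j) t<))

-- The factor `q ^ suc k ℕ.* qint q (suc j)` is the number of points outside a flat of rank `suc k`
-- when `r = k + suc j`.
flag-value : ℕ → ℕ → ℕ → ℕ
flag-value q k zero    = 1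
flag-value q k (suc j) = q ^ suc k ℕ.* qint q (suc j) ℕ.* flag-value q (suc k) j

-- The powers of `q` have exponents `k + 1` to `k + j`, with sum `k j` plus the binomial
-- coefficient; Pascal's rule gives the induction step. The case `k = 0`, `j = r` is the constant of
-- the theorem.
flag-value-formula : ∀ q k j → flag-value q k j ≡ q ^ (k ℕ.* j ℕ.+ suc j C 2) ℕ.* qfact q j
flag-value-formula q k zero    rewrite ℕₚ.*-zeroʳ k = refl
flag-value-formula q k (suc j) = begin
  q ^ suc k ℕ.* a ℕ.* flag-value q (suc k) j                ≡⟨ cong (q ^ suc k ℕ.* a ℕ.*_) (flag-value-formula q (suc k) j) ⟩
  q ^ suc k ℕ.* a ℕ.* (q ^ e ℕ.* qfact q j)               ≡⟨ solve 4 (λ x a y z → x :* a :* (y :* z) := (x :* y) :* (a :* z)) refl (q ^ suc k) a (q ^ e) (qfact q j) ⟩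
  q ^ suc k ℕ.* q ^ e ℕ.* (a ℕ.* qfact q j)               ≡⟨ cong (ℕ._* (a ℕ.* qfact q j)) (ℕₚ.^-distribˡ-+-* q (suc k) e) ⟨
  q ^ (suc k ℕ.+ e) ℕ.* (a ℕ.* qfact q j)                 ≡⟨ cong (λ n → q ^ n ℕ.* (a ℕ.* qfact q j)) exponent ⟩
  q ^ (k ℕ.* suc j ℕ.+ suc (suc j) C 2) ℕ.* qfact q (suc j) ∎
  where
  open ≡-Reasoning
  open ℕ-Solver
  a = qint q (suc j)
  e = suc k ℕ.* j ℕ.+ suc j C 2
  exponent : suc k ℕ.+ e ≡ k ℕ.* suc j ℕ.+ suc (suc j) C 2
  exponent = begin
    suc k ℕ.+ (suc k ℕ.* j ℕ.+ suc j C 2)            ≡⟨ solve 3 (λ k j c → (con 1 :+ k) :+ ((con 1 :+ k) :* j :+ c) := k :* (con 1 :+ j) :+ ((con 1 :+ j) :+ c)) refl k j (suc j C 2) ⟩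
    k ℕ.* suc j ℕ.+ (suc j ℕ.+ suc j C 2)            ≡⟨ cong (λ n → k ℕ.* suc j ℕ.+ (n ℕ.+ suc j C 2)) (nC1≡n (suc j)) ⟨
    k ℕ.* suc j ℕ.+ (suc j C 1 ℕ.+ suc j C 2)        ≡⟨ cong (k ℕ.* suc j ℕ.+_) (nCk+nC[k+1]≡[n+1]C[k+1] (suc j) 1) ⟩
    k ℕ.* suc j ℕ.+ suc (suc j) C 2                  ∎

-- Flats of projective type

-- The rank of a flat is encoded by its size: `qint q t` points stand for rank `t`. The flats here
-- include `⊥`, from which flags are built.
record ProjectiveFlats (q r : ℕ) {N : ℕ} (Flat : Subset N → Set) : Set where
  field
    q≢0   : NonZero q
    total : N ≡ qint q (suc r)
    size  : ∀ S → Flat S → ∃ λ t → ∣ S ∣ ≡ qint q t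
    empty : Flat ⊥
    join  : ∀ F p → Flat F → p ∉ F → ∃ λ J → Flat J × F ⊆ J × p ∈ J × ∣ J ∣ ≡ suc (q ℕ.* ∣ F ∣) ×
            (∀ S → Flat S → F ⊆ S → p ∈ S → J ⊆ S)

proper⇒∣∣<N : ∀ {N} {S : Subset N} → Proper S → ∣ S ∣ < N
proper⇒∣∣<N {N} {S} (x , x∉S) = subst (∣ S ∣ <_) (∣⊤∣≡n N) (p⊂q⇒∣p∣<∣q∣ {p = S} {q = ⊤} (⊆⊤ , x , ∈⊤ , x∉S))

∣∣<N⇒proper : ∀ {N} {S : Subset N} → ∣ S ∣ < N → Proper S
∣∣<N⇒proper {N} {S} lt = Finₚ.¬∀⟶∃¬ N (_∈ S) (_∈? S)
  (λ all → ℕₚ.<⇒≱ lt (subst (_≤ ∣ S ∣) (∣⊤∣≡n N) (p⊆q⇒∣p∣≤∣q∣ {p = ⊤} {q = S} (λ {x} _ → all x))))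

⊆∧∣∣≥⇒≡ : ∀ {N} {S T : Subset N} → S ⊆ T → ∣ T ∣ ≤ ∣ S ∣ → T ≡ S
⊆∧∣∣≥⇒≡ {S = S} {T} S⊆T le = ⊆-antisym T⊆S S⊆T
  where
  T⊆S : T ⊆ S
  T⊆S {x} x∈T with x ∈? S
  ... | yes x∈S = x∈S
  ... | no  x∉S = contradiction (p⊂q⇒∣p∣<∣q∣ (S⊆T , x , x∈T , x∉S)) (ℕₚ.≤⇒≯ le)

module Projective {q r N : ℕ} {Flat : Subset N → Set} (PF : ProjectiveFlats q r Flat) where
  open ProjectiveFlats PF

  NPFlat : Subset N → Set
  NPFlat S = Flat S × Nonempty S × Proper S

  private instance
    q-nonZero : NonZero q
    q-nonZero = q≢0

    N-nonZero : NonZero N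
    N-nonZero = ℕ.>-nonZero (subst (0 <_) (sym total) (qint-mono-< q {0} {suc r} (s≤s z≤n)))

  point : Fin N
  point = fromℕ< (ℕ.>-nonZero⁻¹ N)

  npflat-size : ∀ {S} → NPFlat S → ∃ λ t → t ≤ r × ∣ S ∣ ≡ qint q t
  npflat-size {S} (flat , _ , proper) with size S flat
  ... | t , eq = t , ℕ.s≤s⁻¹ (qint-cancel-< q {t} {suc r} (subst₂ _<_ eq total (proper⇒∣∣<N proper))) , eq

  -- The lower part of a complete flag, largest flat first. The bottom `⊥` is left out of the list,
  -- so `k` is both the rank of the top and the length.
  data Flag : ℕ → Subset N → List (Subset N) → Set where
    []  : Flag 0 ⊥ []
    add : ∀ {k F m J} → Flag k F m → F ⊂ J → NPFlat J → ∣ J ∣ ≡ qint q (suc k) → Flag (suc k) J (J ∷ m)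

  flag-length : ∀ {k F m} → Flag k F m → length m ≡ k
  flag-length []             = refl
  flag-length (add fl _ _ _) = cong suc (flag-length fl)

  flag-size : ∀ {k F m} → Flag k F m → ∣ F ∣ ≡ qint q k
  flag-size []             = ∣⊥∣≡0 N
  flag-size (add _ _ _ eq) = eq

  flag-flat : ∀ {k F m} → Flag k F m → Flat F
  flag-flat []             = empty
  flag-flat (add _ _ np _) = proj₁ np

  flag-all : ∀ {k F m} → Flag k F m → All NPFlat m
  flag-all []              = []
  flag-all (add fl _ np _) = np ∷ flag-all fl

  -- The degree map is normalised on ascending flags, so the descending list has to be reversed;
  -- `ys` accumulates the flats above `F`, and the final `tail` removes `⊥`.
  flag-ʳ++ : ∀ {k F m} ys → Flag k F m → Linked _⊂_ (F ∷ ys) → Linked _⊂_ (m L.ʳ++ ys)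
  flag-ʳ++ ys []               lk = tail lk
  flag-ʳ++ ys (add fl F⊂J _ _) lk = flag-ʳ++ (_ ∷ ys) fl (F⊂J ∷ lk)

  module _ {D : Functional N} (chow : ChowFunctional NPFlat r D) where

    γ-relation : ∀ ks i → qint q (suc i) ∈ˡ ks → length ks ℕ.+ 1 ≡ r → (let G = γ*· ks D) →
      ℕtoℚ (suc q) ℚ.* γ· (qint q (suc i)) G [] ≡ ℕtoℚ q ℚ.* γ· (qint q i) G [] ℚ.+ γ· (qint q (suc (suc i))) G []
    γ-relation ks i ∈ks len = begin
      Q ℚ.* ∑ 𝒫 (λ S → γ N (qint q (suc i)) S ℚ.* G (S ∷ []))       ≡⟨ ∑-*ˡ 𝒫 Q _ ⟨
      ∑ 𝒫 (λ S → Q ℚ.* (γ N (qint q (suc i)) S ℚ.* G (S ∷ [])))     ≡⟨ ∑-cong 𝒫 termwise ⟩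
      ∑ 𝒫 (λ S → ℕtoℚ q ℚ.* (γ N (qint q i) S ℚ.* G (S ∷ [])) ℚ.+ γ N (qint q (suc (suc i))) S ℚ.* G (S ∷ []))
        ≡⟨ ∑-+ 𝒫 (λ S → ℕtoℚ q ℚ.* (γ N (qint q i) S ℚ.* G (S ∷ []))) (λ S → γ N (qint q (suc (suc i))) S ℚ.* G (S ∷ [])) ⟩
      ∑ 𝒫 (λ S → ℕtoℚ q ℚ.* (γ N (qint q i) S ℚ.* G (S ∷ []))) ℚ.+ γ· (qint q (suc (suc i))) G []
        ≡⟨ cong (ℚ._+ γ· (qint q (suc (suc i))) G []) (∑-*ˡ 𝒫 (ℕtoℚ q) _) ⟩
      ℕtoℚ q ℚ.* γ· (qint q i) G [] ℚ.+ γ· (qint q (suc (suc i))) G [] ∎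
      where
      open ≡-Reasoning
      open ℚ-Solver
      𝒫 = allSubsets N
      Q = ℕtoℚ (suc q)
      G = γ*· ks D
      regroup : ∀ {a b c} y → Q ℚ.* a ≡ ℕtoℚ q ℚ.* b ℚ.+ c → Q ℚ.* (a ℚ.* y) ≡ ℕtoℚ q ℚ.* (b ℚ.* y) ℚ.+ c ℚ.* y
      regroup {a} {b} {c} y eq = trans (sym (ℚₚ.*-assoc Q a y)) (trans (cong (ℚ._* y) eq)
        (solve 4 (λ q b c y → (q :* b :+ c) :* y := q :* (b :* y) :+ c :* y) refl (ℕtoℚ q) b c y))
      vanish : ∀ a b c {y} → y ≡ 0ℚ → Q ℚ.* (a ℚ.* y) ≡ ℕtoℚ q ℚ.* (b ℚ.* y) ℚ.+ c ℚ.* y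
      vanish a b c refl = solve 5 (λ Q q a b c → Q :* (a :* con 0ℚ) := q :* (b :* con 0ℚ) :+ c :* con 0ℚ) refl Q (ℕtoℚ q) a b c
      termwise : ∀ S → Q ℚ.* (γ N (qint q (suc i)) S ℚ.* G (S ∷ [])) ≡
                       ℕtoℚ q ℚ.* (γ N (qint q i) S ℚ.* G (S ∷ [])) ℚ.+ γ N (qint q (suc (suc i))) S ℚ.* G (S ∷ [])
      termwise S = by-flatness (γ*·-chow ks 1 chow len) S [] refl vanishing flat
        where
        vanishing = vanish (γ N (qint q (suc i)) S) (γ N (qint q i) S) (γ N (qint q (suc (suc i))) S)
        flat : NPFlat S → _
        flat np with npflat-size np
        -- The coefficient identity can fail only on flats with `qint q (suc i)` points, and the
        -- copy of that class in `ks` annihilates these.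
        ... | t , _ , eq with t ℕ.≟ suc i
        ...   | yes refl = vanishing (γ*·-kill point chow ks S [] (subst (_∈ˡ ks) (sym eq) ∈ks) len)
        ...   | no  t≢   = regroup {γ N (qint q (suc i)) S} {γ N (qint q i) S} {γ N (qint q (suc (suc i))) S} (G (S ∷ [])) (γ-second-difference q i t S eq t≢)

    mixed : List ℕ → ℚ
    mixed c = γ*· (indices q 1 c) D []

    -- As list positions count from 0, position `i` belongs to `qint q (suc i)`. The condition that
    -- the entry is at least 2 lets one copy of this class be moved while another stays in `ks`.
    mixed-harmonic : Harmonic q r mixed
    mixed-harmonic c i len sum≡ i<r 2≤ = begin
      Q ℚ.* mixed c                          ≡⟨ cong (Q ℚ.*_) (γ*·-perm chow (indices-decAt q 1 c i (ℕₚ.<⇒≤ 2≤)) [] (trans (ℕₚ.+-identityʳ _) (trans (length-indices q 1 c) sum≡))) ⟩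
      Q ℚ.* γ· (qint q (suc i)) G []         ≡⟨ γ-relation ks i ∈ks len-ks ⟩
      ℕtoℚ q ℚ.* γ· (qint q i) G [] ℚ.+ γ· (qint q (suc (suc i))) G [] ≡⟨ cong₂ ℚ._+_ (left i i<r refl) right ⟩
      leftTerm q mixed c i ℚ.+ rightTerm r mixed c i ∎
      where
      open ≡-Reasoning
      Q = ℕtoℚ (suc q)
      c′ = decAt c i
      ks = indices q 1 c′
      G = γ*· ks D
      len-ks : length ks ℕ.+ 1 ≡ r
      len-ks = trans (ℕₚ.+-comm (length ks) 1) (trans (cong suc (length-indices q 1 c′)) (trans (sum-decAt c i (ℕₚ.<⇒≤ 2≤)) sum≡))
      ∈ks : qint q (suc i) ∈ˡ ks
      ∈ks = ∈-resp-↭ (↭-sym (indices-decAt q 1 c′ i (nth-decAt c i 2≤))) (here refl)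
      added : ∀ j → j < r → γ· (qint q (suc j)) G [] ≡ mixed (incAt c′ j)
      added j j<r = γ*·-perm chow (↭-sym (indices-incAt q 1 c′ j (subst (j <_) (sym (trans (length-decAt c i) len)) j<r))) []
        (trans (ℕₚ.+-identityʳ _) (trans (ℕₚ.+-comm 1 (length ks)) len-ks))
      left : ∀ j → j < r → j ≡ i → ℕtoℚ q ℚ.* γ· (qint q j) G [] ≡ leftTerm q mixed c j
      left zero    _   _    = trans (cong (ℕtoℚ q ℚ.*_) (γ·-zero G [] γ-0)) (ℚₚ.*-zeroʳ (ℕtoℚ q))
      left (suc j) j<r refl = cong (ℕtoℚ q ℚ.*_) (added j (ℕₚ.<⇒≤ j<r))
      right : γ· (qint q (suc (suc i))) G [] ≡ rightTerm r mixed c i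
      right with rightTerm-cases {r} mixed c i
      ... | inj₁ (i<r′ , eq) = trans (added (suc i) i<r′) (sym eq)
      -- Here `suc i = r`, so the right neighbour is the class of index `N`, which is zero.
      ... | inj₂ (i≮r , eq)  = trans (γ·-zero G [] (subst (λ k → ∀ S → γ N k S ≡ 0ℚ) N≡ γ-top)) (sym eq)
        where
        N≡ : N ≡ qint q (suc (suc i))
        N≡ = trans total (cong (qint q ∘ suc) (ℕₚ.≤-antisym (ℕₚ.≮⇒≥ i≮r) i<r))

    mixed-flag : (∀ m → length m ≡ r → All NPFlat m → Linked _⊂_ m → D m ≡ 1ℚ) →
      ∀ j k {F m} → k ℕ.+ j ≡ r → Flag k F m → γ*· (indices q (suc k) (replicate j 1)) D m ≡ ℕtoℚ (flag-value q k j)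
    mixed-flag flag zero k {F} {m} k+j≡r fl = trans
      (chow .symmetric m (L.reverse m) len (↭-sym (↭-reverse m)))
      (flag (L.reverse m) (trans (↭-length (↭-reverse m)) len) (All-resp-↭ (↭-sym (↭-reverse m)) (flag-all fl)) (flag-ʳ++ [] fl [-]))
      where
      len : length m ≡ r
      len = trans (flag-length fl) (trans (sym (ℕₚ.+-identityʳ k)) k+j≡r)
    mixed-flag flag (suc j) k {F} {m} k+j≡r fl with ∣∣<N⇒proper {S = F} ∣F∣<N
      where
      ∣F∣<N : ∣ F ∣ < N
      ∣F∣<N = subst₂ _<_ (sym (flag-size fl)) (sym total) (qint-mono-< q (s≤s (subst (k ≤_) k+j≡r (ℕₚ.m≤m+n k (suc j)))))
    ... | p , p∉F with join F p (flag-flat fl) p∉F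
    ... | J , flatJ , F⊆J , p∈J , ∣J∣≡ , minimal = begin
      γ· (qint q (suc k)) G m
        -- With `U = ⊤` the condition is that the minimum be `|S|` itself, which holds on the flats
        -- that survive the later classes.
        ≡⟨ γ·-linear chowG (qint q (suc k)) ⊤ m (flag-length fl) p agree ⟩
      (ℕtoℚ (∣ ⊤ {N} ∣) ℚ.- ℕtoℚ (qint q (suc k))) ℚ.* ∑ (allSubsets N) (λ S → sel (lookup S p) (G (S ∷ m)))
        ≡⟨ cong₂ ℚ._*_ coefficient (∑-single J (λ S → sel (lookup S p) (G (S ∷ m))) others) ⟩
      ℕtoℚ (q ^ suc k ℕ.* qint q (suc j)) ℚ.* sel (lookup J p) (G (J ∷ m))
        ≡⟨ cong (λ s → ℕtoℚ (q ^ suc k ℕ.* qint q (suc j)) ℚ.* sel s (G (J ∷ m))) (Vₚ.[]=⇒lookup p∈J) ⟩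
      ℕtoℚ (q ^ suc k ℕ.* qint q (suc j)) ℚ.* G (J ∷ m)
        ≡⟨ cong (ℕtoℚ (q ^ suc k ℕ.* qint q (suc j)) ℚ.*_) (mixed-flag flag j (suc k) k+1+j≡r (add fl (F⊆J , p , p∈J , p∉F) npJ ∣J∣)) ⟩
      ℕtoℚ (q ^ suc k ℕ.* qint q (suc j)) ℚ.* ℕtoℚ (flag-value q (suc k) j)
        ≡⟨ ℕtoℚ-* (q ^ suc k ℕ.* qint q (suc j)) (flag-value q (suc k) j) ⟨
      ℕtoℚ (flag-value q k (suc j)) ∎
      where
      open ≡-Reasoning
      ks = indices q (suc (suc k)) (replicate j 1)
      G = γ*· ks D
      k+1+j≡r : suc k ℕ.+ j ≡ r
      k+1+j≡r = trans (sym (ℕₚ.+-suc k j)) k+j≡r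
      len-ks : length ks ℕ.+ suc k ≡ r
      len-ks = trans (cong (ℕ._+ suc k) (trans (length-indices q (suc (suc k)) (replicate j 1)) (sum-ones j))) (trans (ℕₚ.+-comm j (suc k)) k+1+j≡r)
      chowG : ChowFunctional NPFlat (suc k) G
      chowG = γ*·-chow ks (suc k) chow len-ks
      ∣J∣ : ∣ J ∣ ≡ qint q (suc k)
      ∣J∣ = trans ∣J∣≡ (trans (cong (λ n → suc (q ℕ.* n)) (flag-size fl)) (sym (qint-suc q k)))
      npJ : NPFlat J
      npJ = flatJ , (p , p∈J) , ∣∣<N⇒proper (subst₂ _<_ (sym ∣J∣) (sym total) (qint-mono-< q (s≤s (subst (suc k ≤_) k+1+j≡r (ℕₚ.m≤m+n (suc k) j)))))
      -- The sizes in `ks` are exactly the q-integers of index `k + 2` to `r`.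
      killed : ∀ S t → ∣ S ∣ ≡ qint q t → suc k < t → t ≤ r → G (S ∷ m) ≡ 0ℚ
      killed S t eq k<t t≤r = γ*·-kill point chow ks S m
        (subst (_∈ˡ ks) (sym eq) (∈-indices-ones q (suc (suc k)) j t k<t (s≤s (subst (t ≤_) (sym k+1+j≡r) t≤r))))
        (trans (cong (λ l → length ks ℕ.+ suc l) (flag-length fl)) len-ks)
      agree : ∀ S → ℕtoℚ (∣ S ∣ ⊓ qint q (suc k)) ℚ.* G (S ∷ m) ≡ ℕtoℚ (∣ S ∩ ⊤ ∣) ℚ.* G (S ∷ m)
      agree S = by-flatness chowG S m (flag-length fl) vanishing flat
        where
        vanishing : G (S ∷ m) ≡ 0ℚ → _
        vanishing = *-vanish (ℕtoℚ (∣ S ∣ ⊓ qint q (suc k))) (ℕtoℚ (∣ S ∩ ⊤ ∣))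
        flat : NPFlat S → _
        flat np with npflat-size np
        ... | t , t≤r , eq with suc k <? t
        ...   | yes k<t = vanishing (killed S t eq k<t t≤r)
        ...   | no  k≮t = cong (λ n → ℕtoℚ n ℚ.* G (S ∷ m)) (trans
                  (ℕₚ.m≤n⇒m⊓n≡m (subst (_≤ qint q (suc k)) (sym eq) (qint-mono-≤ q (ℕₚ.≮⇒≥ k≮t))))
                  (cong ∣_∣ (sym (∩-identityʳ S))))
      -- For the empty flag `F` is `⊥` and lies in every `S`. Otherwise `F` heads the monomial, so
      -- `S` is comparable with it or the value vanishes, and `p ∈ S` excludes `S ⊆ F`.
      above : ∀ {k F m} {G : Functional N} → Flag k F m → ChowFunctional NPFlat (suc k) G → p ∉ F → ∀ S → p ∈ S →
              G (S ∷ m) ≡ 0ℚ ⊎ F ⊆ S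
      above []                               chow p∉F S p∈S = inj₂ ⊥⊆
      above (add {m = m} {J = F} fl _ _ _) chow p∉F S p∈S =
        comparable-case chow S F m (flag-length fl) inj₁ (λ S⊆F → contradiction (S⊆F p∈S) p∉F) inj₂
      others : ∀ S → S ≢ J → sel (lookup S p) (G (S ∷ m)) ≡ 0ℚ
      others S S≢J with lookup S p in eqₚ
      ... | outside = refl
      ... | inside  = by-flatness chowG S m (flag-length fl) (λ z → z) flat
        where
        p∈S : p ∈ S
        p∈S = Vₚ.lookup⇒[]= p S eqₚ
        flat : NPFlat S → G (S ∷ m) ≡ 0ℚ
        flat np with npflat-size np | above fl chowG p∉F S p∈S
        ... | _            | inj₁ vanishing = vanishing
        ... | t , t≤r , eq | inj₂ F⊆S with suc k <? t
        ...   | yes k<t = killed S t eq k<t t≤r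
        -- A flat through `F` and `p` contains `J`; being no larger than `J`, it equals `J`.
        ...   | no  k≮t = contradiction (⊆∧∣∣≥⇒≡ (minimal S (proj₁ np) F⊆S p∈S)
                  (subst₂ _≤_ (sym eq) (sym ∣J∣) (qint-mono-≤ q (ℕₚ.≮⇒≥ k≮t)))) S≢J
      coefficient : ℕtoℚ (∣ ⊤ {N} ∣) ℚ.- ℕtoℚ (qint q (suc k)) ≡ ℕtoℚ (q ^ suc k ℕ.* qint q (suc j))
      coefficient = begin
        ℕtoℚ (∣ ⊤ {N} ∣) ℚ.- ℕtoℚ (qint q (suc k))
          ≡⟨ cong (λ n → ℕtoℚ n ℚ.- ℕtoℚ (qint q (suc k))) (trans (∣⊤∣≡n N) (trans total (cong (qint q ∘ suc) (sym k+j≡r)))) ⟩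
        ℕtoℚ (qint q (suc k ℕ.+ suc j)) ℚ.- ℕtoℚ (qint q (suc k))
          ≡⟨ cong (ℚ._- ℕtoℚ (qint q (suc k))) (trans (cong ℕtoℚ (qint-+ q (suc k) (suc j))) (ℕtoℚ-+ (qint q (suc k)) (q ^ suc k ℕ.* qint q (suc j)))) ⟩
        (ℕtoℚ (qint q (suc k)) ℚ.+ ℕtoℚ (q ^ suc k ℕ.* qint q (suc j))) ℚ.- ℕtoℚ (qint q (suc k))
          ≡⟨ solve 2 (λ a b → (a :+ b) :- a := b) refl (ℕtoℚ (qint q (suc k))) (ℕtoℚ (q ^ suc k ℕ.* qint q (suc j))) ⟩
        ℕtoℚ (q ^ suc k ℕ.* qint q (suc j)) ∎
        where open ℚ-Solver

-- Projective spaces over finite fields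

module _ {n : ℕ} {P : Fin n → Set} (P? : ∀ i → Dec (P i)) where

  comprehension : Subset n
  comprehension = V.tabulate (does ∘ P?)

  ∈-comprehension⁺ : ∀ {i} → P i → i ∈ comprehension
  ∈-comprehension⁺ {i} Pi = Vₚ.lookup⇒[]= i comprehension (trans (Vₚ.lookup∘tabulate (does ∘ P?) i) (dec-true (P? i) Pi))

  ∈-comprehension⁻ : ∀ {i} → i ∈ comprehension → P i
  ∈-comprehension⁻ {i} i∈ with P? i | trans (sym (Vₚ.lookup∘tabulate (does ∘ P?) i)) (Vₚ.[]=⇒lookup i∈)
  ... | yes Pi | _ = Pi

-- Counting the elements of finite subsets

∣remove∣ : ∀ {n} {S : Subset n} {i} → i ∈ S → ∣ S ∣ ≡ suc ∣ S [ i ]≔ outside ∣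
∣remove∣ here                          = refl
∣remove∣ {S = inside  ∷ S} (there i∈S) = cong suc (∣remove∣ i∈S)
∣remove∣ {S = outside ∷ S} (there i∈S) = ∣remove∣ i∈S

∣image∣ : ∀ {n k} (S : Subset n) (e : Fin k → Fin n) → (∀ {s t} → e s ≡ e t → s ≡ t) →
          (∀ s → e s ∈ S) → (∀ {i} → i ∈ S → ∃ λ s → e s ≡ i) → ∣ S ∣ ≡ k
∣image∣ {n} {zero} S e inj into onto = trans (cong ∣_∣ (Empty-unique (λ (i , i∈S) → Finₚ.¬Fin0 (proj₁ (onto i∈S))))) (∣⊥∣≡0 n)
∣image∣ {n} {suc k} S e inj into onto =
  trans (∣remove∣ (into zero)) (cong suc (∣image∣ (S [ e zero ]≔ outside) (e ∘ suc) (Finₚ.suc-injective ∘ inj) into′ onto′))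
  where
  into′ : ∀ s → e (suc s) ∈ S [ e zero ]≔ outside
  into′ s = Vₚ.[]≔-minimal S _ _ (λ eq → Finₚ.0≢1+n (sym (inj eq))) (into (suc s))
  onto′ : ∀ {i} → i ∈ S [ e zero ]≔ outside → ∃ λ s → e (suc s) ≡ i
  onto′ {i} i∈ with i Fin.≟ e zero
  ... | yes refl = contradiction (trans (sym (Vₚ.[]=⇒lookup i∈)) (Vₚ.lookup∘updateAt (e zero) S)) (λ ())
  ... | no  i≢ with onto (Vₚ.lookup⇒[]= i S (trans (sym (Vₚ.lookup∘updateAt′ i (e zero) i≢ S)) (Vₚ.[]=⇒lookup i∈)))
  ...   | zero  , eq = contradiction (sym eq) i≢
  ...   | suc s , eq = s , eq

record Enumeration {n : ℕ} (S : Subset n) : Set where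
  field
    element   : Fin ∣ S ∣ → Fin n
    injective : ∀ {s t} → element s ≡ element t → s ≡ t
    into      : ∀ s → element s ∈ S
    onto      : ∀ {i} → i ∈ S → ∃ λ s → element s ≡ i

enumerate : ∀ {n} (S : Subset n) → Enumeration S
enumerate [] = record { element = λ () ; injective = λ { {()} } ; into = λ () ; onto = λ () }
enumerate (outside ∷ S) = record
  { element   = suc ∘ element
  ; injective = injective ∘ Finₚ.suc-injective
  ; into      = λ s → there (into s)
  ; onto      = λ { (there i∈S) → let s , eq = onto i∈S in s , cong suc eq }
  }
  where open Enumeration (enumerate S)
enumerate {suc n} (inside ∷ S) = record
  { element   = el
  ; injective = inj
  ; into      = λ { zero → here ; (suc s) → there (into s) }
  ; onto      = λ { here → zero , refl ; (there i∈S) → let s , eq = onto i∈S in suc s , cong suc eq }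
  }
  where
  open Enumeration (enumerate S)
  el : Fin (suc ∣ S ∣) → Fin (suc n)
  el zero    = zero
  el (suc s) = suc (element s)
  inj : ∀ {s t} → el s ≡ el t → s ≡ t
  inj {zero}  {zero}  eq = refl
  inj {suc s} {suc t} eq = cong suc (injective (Finₚ.suc-injective eq))

-- Linear algebra over a finite field

module VectorSpace {q : ℕ} (F : FiniteField q) where
  open FiniteField F

  commutativeRing : CommutativeRing _ _
  commutativeRing = record { isCommutativeRing = isCommutativeRing }

  open CommutativeRing commutativeRing public
    using (ring; *-assoc; *-comm; *-identityˡ; *-identityʳ; zeroˡ; zeroʳ; distribˡ; distribʳ; +-assoc; +-comm; +-identityˡ; +-identityʳ; -‿inverseʳ; -‿inverseˡ)
  open RingProperties ring public using (-‿distribˡ-*)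

  infixl 6 _⊕_
  infixr 7 _·_
  _⊕_ : ∀ {n} → Vec Carrier n → Vec Carrier n → Vec Carrier n
  _⊕_ = addV F
  _·_ : ∀ {n} → Carrier → Vec Carrier n → Vec Carrier n
  _·_ = scale F
  𝟎 : ∀ {n} → Vec Carrier n
  𝟎 = zeroV F

  _≟C_ : (x y : Carrier) → Dec (x ≡ y)
  _≟C_ = via-injection (↔⇒↣ (↔-sym enum)) Fin._≟_

  _≟V_ : ∀ {n} (u v : Vec Carrier n) → Dec (u ≡ v)
  _≟V_ = Vₚ.≡-dec _≟C_

  q-nonZero : NonZero q
  q-nonZero = ℕ.>-nonZero (ℕₚ.≤-<-trans z≤n (Finₚ.toℕ<n (Inverse.from enum 0#)))

  ·-assoc : ∀ {n} a b (v : Vec Carrier n) → a · b · v ≡ (a * b) · v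
  ·-assoc a b []      = refl
  ·-assoc a b (x ∷ v) = cong₂ _∷_ (sym (*-assoc a b x)) (·-assoc a b v)

  ·-identity : ∀ {n} (v : Vec Carrier n) → 1# · v ≡ v
  ·-identity []      = refl
  ·-identity (x ∷ v) = cong₂ _∷_ (*-identityˡ x) (·-identity v)

  ·-zeroˡ : ∀ {n} (v : Vec Carrier n) → 0# · v ≡ 𝟎
  ·-zeroˡ []      = refl
  ·-zeroˡ (x ∷ v) = cong₂ _∷_ (zeroˡ x) (·-zeroˡ v)

  ·-zeroʳ : ∀ {n} a → a · 𝟎 {n} ≡ 𝟎
  ·-zeroʳ {zero}  a = refl
  ·-zeroʳ {suc n} a = cong₂ _∷_ (zeroʳ a) (·-zeroʳ a)

  ·-⊕ : ∀ {n} a (u v : Vec Carrier n) → a · (u ⊕ v) ≡ a · u ⊕ a · v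
  ·-⊕ a []      []      = refl
  ·-⊕ a (x ∷ u) (y ∷ v) = cong₂ _∷_ (distribˡ a x y) (·-⊕ a u v)

  +-· : ∀ {n} a b (v : Vec Carrier n) → (a + b) · v ≡ a · v ⊕ b · v
  +-· a b []      = refl
  +-· a b (x ∷ v) = cong₂ _∷_ (distribʳ x a b) (+-· a b v)

  ⊕-comm : ∀ {n} (u v : Vec Carrier n) → u ⊕ v ≡ v ⊕ u
  ⊕-comm = Vₚ.zipWith-comm +-comm

  ⊕-assoc : ∀ {n} (u v w : Vec Carrier n) → u ⊕ v ⊕ w ≡ u ⊕ (v ⊕ w)
  ⊕-assoc = Vₚ.zipWith-assoc +-assoc

  ⊕-identityˡ : ∀ {n} (v : Vec Carrier n) → 𝟎 ⊕ v ≡ v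
  ⊕-identityˡ = Vₚ.zipWith-identityˡ +-identityˡ

  ⊕-identityʳ : ∀ {n} (v : Vec Carrier n) → v ⊕ 𝟎 ≡ v
  ⊕-identityʳ = Vₚ.zipWith-identityʳ +-identityʳ

  ⊕-interchange : ∀ {n} (u v w x : Vec Carrier n) → (u ⊕ v) ⊕ (w ⊕ x) ≡ (u ⊕ w) ⊕ (v ⊕ x)
  ⊕-interchange u v w x = begin
    (u ⊕ v) ⊕ (w ⊕ x) ≡⟨ ⊕-assoc u v (w ⊕ x) ⟩
    u ⊕ (v ⊕ (w ⊕ x)) ≡⟨ cong (u ⊕_) (trans (sym (⊕-assoc v w x)) (trans (cong (_⊕ x) (⊕-comm v w)) (⊕-assoc w v x))) ⟩
    u ⊕ (w ⊕ (v ⊕ x)) ≡⟨ ⊕-assoc u w (v ⊕ x) ⟨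
    (u ⊕ w) ⊕ (v ⊕ x) ∎
    where open ≡-Reasoning

  ·-inverse : ∀ {n} (v : Vec Carrier n) → v ⊕ (- 1#) · v ≡ 𝟎
  ·-inverse v = trans (cong (_⊕ (- 1#) · v) (sym (·-identity v)))
    (trans (sym (+-· 1# (- 1#) v)) (trans (cong (_· v) (-‿inverseʳ 1#)) (·-zeroˡ v)))

  combine-· : ∀ {n} x a y b (v w : Vec Carrier n) u → x · (a · v ⊕ u) ⊕ y · (b · v ⊕ w) ≡ (x * a + y * b) · v ⊕ (x · u ⊕ y · w)
  combine-· x a y b v w u = begin
    x · (a · v ⊕ u) ⊕ y · (b · v ⊕ w)                   ≡⟨ cong₂ _⊕_ (·-⊕ x (a · v) u) (·-⊕ y (b · v) w) ⟩
    (x · a · v ⊕ x · u) ⊕ (y · b · v ⊕ y · w)           ≡⟨ ⊕-interchange (x · a · v) (x · u) (y · b · v) (y · w) ⟩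
    (x · a · v ⊕ y · b · v) ⊕ (x · u ⊕ y · w)           ≡⟨ cong (_⊕ (x · u ⊕ y · w)) (cong₂ _⊕_ (·-assoc x a v) (·-assoc y b v)) ⟩
    ((x * a) · v ⊕ (y * b) · v) ⊕ (x · u ⊕ y · w)       ≡⟨ cong (_⊕ (x · u ⊕ y · w)) (+-· (x * a) (y * b) v) ⟨
    (x * a + y * b) · v ⊕ (x · u ⊕ y · w)               ∎
    where open ≡-Reasoning

  ·-cancel : ∀ {n} {a} {v : Vec Carrier n} → a ≢ 0# → ∃ λ y → y · a · v ≡ v
  ·-cancel {a = a} {v} a≢0 with inverse a a≢0
  ... | y , ay≡1 = y , trans (·-assoc y a v) (trans (cong (_· v) (trans (*-comm y a) ay≡1)) (·-identity v))

  ·-nonzero : ∀ {n} {a} {v w : Vec Carrier n} → w ≡ a · v → w ≢ 𝟎 → a ≢ 0#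
  ·-nonzero {v = v} eq w≢0 refl = w≢0 (trans eq (·-zeroˡ v))

  ·≡𝟎⇒≡0 : ∀ {n} {a} {v : Vec Carrier n} → v ≢ 𝟎 → a · v ≡ 𝟎 → a ≡ 0#
  ·≡𝟎⇒≡0 {a = a} v≢0 eq with a ≟C 0#
  ... | yes a≡0 = a≡0
  ... | no  a≢0 with ·-cancel a≢0
  ...   | y , yav≡v = contradiction (trans (sym yav≡v) (trans (cong (y ·_) eq) (·-zeroʳ y))) v≢0

  -- Differences are written with the scalar `- 1#` because vectors are subtracted by scaling and
  -- adding.
  x+-y≡0⇒x≡y : ∀ {x y} → x + (- 1#) * y ≡ 0# → x ≡ y
  x+-y≡0⇒x≡y {x} {y} eq = begin
    x                       ≡⟨ +-identityʳ x ⟨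
    x + 0#                  ≡⟨ cong (x +_) (-‿inverseˡ y) ⟨
    x + (- y + y)           ≡⟨ +-assoc x (- y) y ⟨
    x + - y + y             ≡⟨ cong (λ z → x + z + y) (trans (cong -_ (sym (*-identityˡ y))) (-‿distribˡ-* 1# y)) ⟩
    x + (- 1#) * y + y      ≡⟨ cong (_+ y) eq ⟩
    0# + y                  ≡⟨ +-identityˡ y ⟩
    y                       ∎
    where open ≡-Reasoning

  ·-injectiveˡ : ∀ {n} {a b} {v : Vec Carrier n} → v ≢ 𝟎 → a · v ≡ b · v → a ≡ b
  ·-injectiveˡ {a = a} {b} {v} v≢0 eq = x+-y≡0⇒x≡y (·≡𝟎⇒≡0 v≢0 (begin
    (a + (- 1#) * b) · v          ≡⟨ +-· a ((- 1#) * b) v ⟩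
    a · v ⊕ ((- 1#) * b) · v      ≡⟨ cong₂ _⊕_ eq (sym (·-assoc (- 1#) b v)) ⟩
    b · v ⊕ (- 1#) · b · v        ≡⟨ ·-inverse (b · v) ⟩
    𝟎                             ∎))
    where open ≡-Reasoning

  ⊕-cancelˡ : ∀ {n} (u : Vec Carrier n) {v w} → u ⊕ v ≡ u ⊕ w → v ≡ w
  ⊕-cancelˡ u {v} {w} eq = trans (sym (undo v)) (trans (cong ((- 1#) · u ⊕_) eq) (undo w))
    where
    undo : ∀ x → (- 1#) · u ⊕ (u ⊕ x) ≡ x
    undo x = trans (sym (⊕-assoc ((- 1#) · u) u x)) (trans (cong (_⊕ x) (trans (⊕-comm _ u) (·-inverse u))) (⊕-identityˡ x))

  lookup-⊕ : ∀ {n} (u v : Vec Carrier n) i → lookup (u ⊕ v) i ≡ lookup u i + lookup v i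
  lookup-⊕ u v i = Vₚ.lookup-zipWith _+_ i u v

  lookup-· : ∀ {n} a (v : Vec Carrier n) i → lookup (a · v) i ≡ a * lookup v i
  lookup-· a v i = Vₚ.lookup-map i (a *_) v

-- Projective subspaces and joins with a point

module ProjectiveSpace {q r N : ℕ} (F : FiniteField q) {pt : Fin N → Vec (FiniteField.Carrier F) (suc r)}
                       (rep : IsProjRep F r N pt) where
  open FiniteField F
  open VectorSpace F
  open IsProjRep rep

  Flat : Subset N → Set
  Flat = IsProjSubspace F pt

  -- For a flat `S` this is the linear subspace whose projectivisation is `S`; multiples of single
  -- points suffice by `span-⊕`.
  Span : Subset N → Vec Carrier (suc r) → Set
  Span S v = v ≡ 𝟎 ⊎ ∃ λ i → i ∈ S × ∃ λ c → v ≡ c · pt i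

  abstract
    representative : ∀ {v} → v ≢ 𝟎 → ∃ λ k → (∃ λ a → v ≡ a · pt k) × (∃ λ y → pt k ≡ y · v)
    representative {v} v≢0 with covers v v≢0
    ... | k , a , v≡ with ·-cancel {v = pt k} (·-nonzero v≡ v≢0)
    ...   | y , yak≡k = k , (a , v≡) , (y , trans (sym yak≡k) (cong (y ·_) (sym v≡)))

  span-pt⁺ : ∀ {S k} → k ∈ S → Span S (pt k)
  span-pt⁺ k∈S = inj₂ (_ , k∈S , 1# , sym (·-identity _))

  span-pt⁻ : ∀ {S k} → Span S (pt k) → k ∈ S
  span-pt⁻ {k = k} (inj₁ k≡0)             = contradiction k≡0 (nonzero k)
  span-pt⁻ {S} {k} (inj₂ (i , i∈S , c , k≡ci)) = subst (_∈ S) (sym (distinct k i c k≡ci)) i∈S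

  span-· : ∀ {S v} a → Span S v → Span S (a · v)
  span-· a (inj₁ refl)                = inj₁ (·-zeroʳ a)
  span-· a (inj₂ (i , i∈S , c , v≡))  = inj₂ (i , i∈S , a * c , trans (cong (a ·_) v≡) (·-assoc a c (pt i)))

  -- A nonzero sum of multiples of two points represents a point on the line through them, which the
  -- flat contains.
  span-⊕ : ∀ {S u v} → Flat S → Span S u → Span S v → Span S (u ⊕ v)
  span-⊕ {S} flat (inj₁ refl) sv = subst (Span S) (sym (⊕-identityˡ _)) sv
  span-⊕ {S} flat su (inj₁ refl) = subst (Span S) (sym (⊕-identityʳ _)) su
  span-⊕ {S} {u} {v} flat (inj₂ (i , i∈S , c , u≡)) (inj₂ (j , j∈S , d , v≡)) with (u ⊕ v) ≟V 𝟎
  ... | yes ≡0 = inj₁ ≡0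
  ... | no  ≢0 with representative ≢0
  ...   | k , (a , w≡) , (y , k≡) = inj₂ (k , flat i j k i∈S j∈S (y * c , y * d , k≡′) , a , w≡)
    where
    open ≡-Reasoning
    k≡′ : pt k ≡ (y * c) · pt i ⊕ (y * d) · pt j
    k≡′ = begin
      pt k                              ≡⟨ k≡ ⟩
      y · (u ⊕ v)                       ≡⟨ ·-⊕ y u v ⟩
      y · u ⊕ y · v                     ≡⟨ cong₂ (λ u v → y · u ⊕ y · v) u≡ v≡ ⟩
      y · c · pt i ⊕ y · d · pt j       ≡⟨ cong₂ _⊕_ (·-assoc y c (pt i)) (·-assoc y d (pt j)) ⟩
      (y * c) · pt i ⊕ (y * d) · pt j   ∎

  flat-⊕ : ∀ {S T p k u} a → Flat T → S ⊆ T → p ∈ T → Span S u → pt k ≡ a · pt p ⊕ u → k ∈ T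
  -- A multiple of `pt p` alone is treated as a combination of `p` with itself, with second
  -- coefficient `0#`.
  flat-⊕ {p = p} {k} a flat S⊆T p∈T (inj₁ refl) k≡ = flat p p k p∈T p∈T
    (a , 0# , trans k≡ (cong (a · pt p ⊕_) (sym (·-zeroˡ (pt p)))))
  flat-⊕ {p = p} {k} a flat S⊆T p∈T (inj₂ (i , i∈S , c , refl)) k≡ = flat p i k p∈T (S⊆T i∈S) (a , c , k≡)

  empty-flat : Flat ⊥
  empty-flat i j k i∈⊥ = contradiction i∈⊥ ∉⊥

  module Join {S : Subset N} (flat : Flat S) {p : Fin N} (p∉S : p ∉ S) where

    -- If `b` were nonzero, division by it would put `pt p` in the span of `S`, and hence `p` in
    -- `S`.
    independent-zero : ∀ {b u} → Span S u → b · pt p ⊕ u ≡ 𝟎 → b ≡ 0#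
    independent-zero {b} {u} su eq with b ≟C 0#
    ... | yes b≡0 = b≡0
    ... | no  b≢0 with ·-cancel {v = pt p} b≢0
    ...   | y , ybp≡p = contradiction (span-pt⁻ (subst (Span S) (sym p≡) (span-· y (span-· (- 1#) su)))) p∉S
      where
      bp≡ : b · pt p ≡ (- 1#) · u
      bp≡ = ⊕-cancelˡ u (trans (⊕-comm u (b · pt p)) (trans eq (sym (·-inverse u))))
      p≡ : pt p ≡ y · (- 1#) · u
      p≡ = trans (sym ybp≡p) (cong (y ·_) bp≡)

    independent : ∀ {b b′ u u′} → Span S u → Span S u′ → b · pt p ⊕ u ≡ b′ · pt p ⊕ u′ → b ≡ b′ × u ≡ u′
    independent {b} {b′} {u} {u′} su su′ eq = b≡b′ , ⊕-cancelˡ (b · pt p) (trans eq (cong (λ b → b · pt p ⊕ u′) (sym b≡b′)))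
      where
      open ≡-Reasoning
      b≡b′ : b ≡ b′
      b≡b′ = x+-y≡0⇒x≡y (trans (cong (_+ (- 1#) * b′) (sym (*-identityˡ b))) (independent-zero
        (span-⊕ flat (span-· 1# su) (span-· (- 1#) su′)) (begin
          (1# * b + (- 1#) * b′) · pt p ⊕ (1# · u ⊕ (- 1#) · u′)      ≡⟨ combine-· 1# b (- 1#) b′ (pt p) u′ u ⟨
          1# · (b · pt p ⊕ u) ⊕ (- 1#) · (b′ · pt p ⊕ u′)             ≡⟨ cong₂ _⊕_ (trans (·-identity _) eq) refl ⟩
          (b′ · pt p ⊕ u′) ⊕ (- 1#) · (b′ · pt p ⊕ u′)                ≡⟨ ·-inverse _ ⟩
          𝟎                                                           ∎)))

    open Enumeration (enumerate S)

    -- The coefficient of the point of `S` is normalised to 1, which picks one vector for each point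
    -- other than `p` on its line through `p`.
    vector : Fin ∣ S ∣ → Fin q → Vec Carrier (suc r)
    vector s t = Inverse.to enum t · pt p ⊕ pt (element s)

    vector≢𝟎 : ∀ s t → vector s t ≢ 𝟎
    vector≢𝟎 s t eq = nonzero (element s) (proj₂ (independent (span-pt⁺ (into s)) (inj₁ refl)
      (trans eq (sym (trans (⊕-identityʳ _) (·-zeroˡ (pt p)))))))

    abstract
      line-point : Fin ∣ S ∣ → Fin q → Fin N
      line-point s t = proj₁ (representative (vector≢𝟎 s t))

      line-point-spec : ∀ s t → (∃ λ a → vector s t ≡ a · pt (line-point s t)) × (∃ λ y → pt (line-point s t) ≡ y · vector s t)
      line-point-spec s t = proj₂ (representative (vector≢𝟎 s t))

    base : Fin (∣ S ∣ ℕ.* q) → Fin ∣ S ∣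
    base x = proj₁ (remQuot {∣ S ∣} q x)

    coefficient : Fin (∣ S ∣ ℕ.* q) → Fin q
    coefficient x = proj₂ (remQuot {∣ S ∣} q x)

    -- Besides p, each line through p and a point of S contributes its q other points.
    joinPoint : Fin (suc (∣ S ∣ ℕ.* q)) → Fin N
    joinPoint zero    = p
    joinPoint (suc x) = line-point (base x) (coefficient x)

    -- Comparing the components in the span of `S` would force the scalar `y` to be 0.
    line-point≢p : ∀ s t → line-point s t ≢ p
    line-point≢p s t eq with line-point-spec s t
    ... | _ , (y , k≡) = contradiction (trans k≡ (trans (cong (_· vector s t) y≡0) (·-zeroˡ _))) (nonzero (line-point s t))
      where
      open ≡-Reasoning
      b = Inverse.to enum t
      y≡0 : y ≡ 0#
      y≡0 = ·≡𝟎⇒≡0 (nonzero (element s)) (proj₂ (independent {y * b} {1#} (span-· y (span-pt⁺ (into s))) (inj₁ refl) (begin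
        (y * b) · pt p ⊕ y · pt (element s)       ≡⟨ cong (_⊕ y · pt (element s)) (·-assoc y b (pt p)) ⟨
        y · b · pt p ⊕ y · pt (element s)         ≡⟨ ·-⊕ y (b · pt p) (pt (element s)) ⟨
        y · vector s t                            ≡⟨ k≡ ⟨
        pt (line-point s t)                       ≡⟨ cong pt eq ⟩
        pt p                                      ≡⟨ trans (⊕-identityʳ _) (·-identity (pt p)) ⟨
        1# · pt p ⊕ 𝟎                             ∎)))

    -- Equal points have proportional vectors. The components in the span of `S` give `s = s′`, then
    -- the normalisation makes the ratio `e` equal to 1, and the coefficients of `pt p` give
    -- `t = t′`.
    line-point-injective : ∀ s t s′ t′ → line-point s t ≡ line-point s′ t′ → s ≡ s′ × t ≡ t′
    line-point-injective s t s′ t′ eq with line-point-spec s t | line-point-spec s′ t′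
    ... | (a , w≡) , _ | _ , (y′ , k′≡) = s≡s′ , t≡t′
      where
      open ≡-Reasoning
      b  = Inverse.to enum t
      b′ = Inverse.to enum t′
      e  = a * y′
      proportional : b · pt p ⊕ pt (element s) ≡ (e * b′) · pt p ⊕ e · pt (element s′)
      proportional = begin
        vector s t                                       ≡⟨ w≡ ⟩
        a · pt (line-point s t)                          ≡⟨ cong (λ k → a · pt k) eq ⟩
        a · pt (line-point s′ t′)                        ≡⟨ cong (a ·_) k′≡ ⟩
        a · y′ · vector s′ t′                            ≡⟨ ·-assoc a y′ _ ⟩
        e · vector s′ t′                                 ≡⟨ ·-⊕ e (b′ · pt p) (pt (element s′)) ⟩
        e · b′ · pt p ⊕ e · pt (element s′)              ≡⟨ cong (_⊕ e · pt (element s′)) (·-assoc e b′ (pt p)) ⟩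
        (e * b′) · pt p ⊕ e · pt (element s′)            ∎
      coordinates : b ≡ e * b′ × pt (element s) ≡ e · pt (element s′)
      coordinates = independent (span-pt⁺ (into s)) (span-· e (span-pt⁺ (into s′))) proportional
      s≡s′ : s ≡ s′
      s≡s′ = injective (distinct _ _ e (proj₂ coordinates))
      e≡1 : e ≡ 1#
      e≡1 = ·-injectiveˡ {a = e} {1#} {pt (element s)} (nonzero (element s)) (begin
        e · pt (element s)       ≡⟨ cong (λ s → e · pt (element s)) s≡s′ ⟩
        e · pt (element s′)      ≡⟨ proj₂ coordinates ⟨
        pt (element s)           ≡⟨ ·-identity (pt (element s)) ⟨
        1# · pt (element s)      ∎)
      t≡t′ : t ≡ t′
      t≡t′ = trans (sym (Inverse.strictlyInverseʳ enum t)) (trans (cong (Inverse.from enum)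
        (trans (proj₁ coordinates) (trans (cong (_* b′) e≡1) (*-identityˡ b′)))) (Inverse.strictlyInverseʳ enum t′))

    joinPoint-injective : ∀ {x y} → joinPoint x ≡ joinPoint y → x ≡ y
    joinPoint-injective {zero}  {zero}  eq = refl
    joinPoint-injective {zero}  {suc y} eq = contradiction (sym eq) (line-point≢p (base y) (coefficient y))
    joinPoint-injective {suc x} {zero}  eq = contradiction eq (line-point≢p (base x) (coefficient x))
    joinPoint-injective {suc x} {suc y} eq with line-point-injective (base x) (coefficient x) (base y) (coefficient y) eq
    ... | eq₁ , eq₂ = cong suc (trans (sym (Finₚ.combine-remQuot {∣ S ∣} q x)) (trans (cong₂ combine eq₁ eq₂) (Finₚ.combine-remQuot {∣ S ∣} q y)))

    -- The linear description of the join, from which closure and minimality follow; the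
    -- parametrisation `joinPoint` gives its size.
    InJoin : Fin N → Set
    InJoin k = ∃ λ a → ∃ λ u → Span S u × pt k ≡ a · pt p ⊕ u

    p-inJoin : InJoin p
    p-inJoin = 1# , 𝟎 , inj₁ refl , sym (trans (⊕-identityʳ _) (·-identity (pt p)))

    joinPoint-inJoin : ∀ x → InJoin (joinPoint x)
    joinPoint-inJoin zero    = p-inJoin
    joinPoint-inJoin (suc x) = go (base x) (coefficient x)
      where
      go : ∀ s t → InJoin (line-point s t)
      go s t with line-point-spec s t
      ... | _ , (y , k≡) = y * Inverse.to enum t , y · pt (element s) , span-· y (span-pt⁺ (into s)) ,
        trans k≡ (trans (·-⊕ y _ _) (cong (_⊕ y · pt (element s)) (·-assoc y _ (pt p))))

    inJoin-joinPoint : ∀ {k} → InJoin k → ∃ λ x → joinPoint x ≡ k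
    inJoin-joinPoint {k} (a , u , inj₁ refl , k≡) = zero , sym (distinct k p a (trans k≡ (⊕-identityʳ _)))
    inJoin-joinPoint {k} (a , u , inj₂ (i , i∈S , c , refl) , k≡) with c ≟C 0#
    ... | yes refl = zero , sym (distinct k p a (trans k≡ (trans (cong (a · pt p ⊕_) (·-zeroˡ (pt i))) (⊕-identityʳ _))))
    ... | no  c≢0 with inverse c c≢0 | onto i∈S
    ...   | z , cz≡1 | s , refl = suc (combine s t) , trans (cong (λ (s , t) → line-point s t) (Finₚ.remQuot-combine s t)) found
      where
      open ≡-Reasoning
      -- As `z` is the inverse of `c`, dividing `a · pt p ⊕ c · pt i` by `c` leaves the coefficient
      -- `z * a` at `pt p`.
      t = Inverse.from enum (z * a)
      k≡cw : pt k ≡ c · vector s t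
      k≡cw = begin
        pt k                                                ≡⟨ k≡ ⟩
        a · pt p ⊕ c · pt (element s)                       ≡⟨ cong (λ a → a · pt p ⊕ c · pt (element s)) (trans (sym (*-identityˡ a)) (trans (cong (_* a) (sym cz≡1)) (*-assoc c z a))) ⟩
        (c * (z * a)) · pt p ⊕ c · pt (element s)           ≡⟨ cong (_⊕ c · pt (element s)) (·-assoc c (z * a) (pt p)) ⟨
        c · (z * a) · pt p ⊕ c · pt (element s)             ≡⟨ ·-⊕ c ((z * a) · pt p) (pt (element s)) ⟨
        c · ((z * a) · pt p ⊕ pt (element s))               ≡⟨ cong (λ b → c · (b · pt p ⊕ pt (element s))) (Inverse.strictlyInverseˡ enum (z * a)) ⟨
        c · vector s t                                      ∎
      found : line-point s t ≡ k
      found with line-point-spec s t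
      ... | (a′ , w≡) , _ = sym (distinct k _ (c * a′) (trans k≡cw (trans (cong (c ·_) w≡) (·-assoc c a′ (pt (line-point s t))))))

    J : Subset N
    J = comprehension (λ k → Finₚ.any? (λ x → joinPoint x Fin.≟ k))

    ∈J⁺ : ∀ {k} → InJoin k → k ∈ J
    ∈J⁺ k∈ = ∈-comprehension⁺ (λ k → Finₚ.any? (λ x → joinPoint x Fin.≟ k)) (inJoin-joinPoint k∈)

    ∈J⁻ : ∀ {k} → k ∈ J → InJoin k
    ∈J⁻ {k} k∈ with ∈-comprehension⁻ (λ k → Finₚ.any? (λ x → joinPoint x Fin.≟ k)) k∈
    ... | x , refl = joinPoint-inJoin x

    ∣J∣ : ∣ J ∣ ≡ suc (q ℕ.* ∣ S ∣)
    ∣J∣ = trans (∣image∣ J joinPoint joinPoint-injective (∈J⁺ ∘ joinPoint-inJoin) (inJoin-joinPoint ∘ ∈J⁻)) (cong suc (ℕₚ.*-comm ∣ S ∣ q))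

    J-flat : Flat J
    J-flat i j k i∈J j∈J (x , y , k≡) with ∈J⁻ i∈J | ∈J⁻ j∈J
    ... | a , u , su , i≡ | b , w , sw , j≡ = ∈J⁺ (x * a + y * b , x · u ⊕ y · w , span-⊕ flat (span-· x su) (span-· y sw) ,
      trans k≡ (trans (cong₂ (λ v w → x · v ⊕ y · w) i≡ j≡) (combine-· x a y b (pt p) w u)))

    S⊆J : S ⊆ J
    S⊆J {k} k∈S = ∈J⁺ (0# , pt k , span-pt⁺ k∈S , sym (trans (cong (_⊕ pt k) (·-zeroˡ (pt p))) (⊕-identityˡ _)))

    p∈J : p ∈ J
    p∈J = ∈J⁺ p-inJoin

    J-minimal : ∀ T → Flat T → S ⊆ T → p ∈ T → J ⊆ T
    J-minimal T flatT S⊆T p∈T k∈J with ∈J⁻ k∈J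
    ... | a , u , su , k≡ = flat-⊕ a flatT S⊆T p∈T su k≡

  -- `S` is exhausted from below: starting with `⊥`, missing points of `S` are joined one after
  -- another, and each join raises the index of the q-integer by one. The number `fuel` bounds how
  -- many points are still missing.
  flat-size : ∀ S → Flat S → ∃ λ t → ∣ S ∣ ≡ qint q t
  flat-size S flatS = grow ∣ S ∣ ⊥ 0 empty-flat ⊥⊆ (∣⊥∣≡0 N) (ℕₚ.m≤n+m ∣ S ∣ _)
    where
    grow : ∀ fuel T t → Flat T → T ⊆ S → ∣ T ∣ ≡ qint q t → ∣ S ∣ ≤ ∣ T ∣ ℕ.+ fuel → ∃ λ t → ∣ S ∣ ≡ qint q t
    grow fuel T t flatT T⊆S ∣T∣ bound with Finₚ.any? (λ x → (x ∈? S) ×-dec ¬? (x ∈? T))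
    ... | no none = t , trans (cong ∣_∣ (⊆-antisym S⊆T T⊆S)) ∣T∣
      where
      S⊆T : S ⊆ T
      S⊆T {x} x∈S with x ∈? T
      ... | yes x∈T = x∈T
      ... | no  x∉T = contradiction (x , x∈S , x∉T) none
    grow zero T t flatT T⊆S ∣T∣ bound | yes (x , x∈S , x∉T) =
      contradiction (subst (∣ S ∣ ≤_) (ℕₚ.+-identityʳ ∣ T ∣) bound) (ℕₚ.<⇒≱ (p⊂q⇒∣p∣<∣q∣ (T⊆S , x , x∈S , x∉T)))
    grow (suc fuel) T t flatT T⊆S ∣T∣ bound | yes (x , x∈S , x∉T) =
      grow fuel J (suc t) J-flat (J-minimal S flatS T⊆S x∈S)
        (trans ∣J∣ (trans (cong (λ n → suc (q ℕ.* n)) ∣T∣) (sym (qint-suc q t))))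
        (ℕₚ.≤-trans bound (subst (_≤ ∣ J ∣ ℕ.+ fuel) (sym (ℕₚ.+-suc ∣ T ∣ fuel)) (ℕₚ.+-monoˡ-≤ fuel (p⊂q⇒∣p∣<∣q∣ (S⊆J , x , p∈J , x∉T)))))
      where open Join flatT x∉T

  -- Coordinate subspaces and the number of points

  VanishesFrom : ℕ → Vec Carrier (suc r) → Set
  VanishesFrom k v = ∀ j → k ≤ toℕ j → lookup v j ≡ 0#

  vanishesFrom-· : ∀ k a v → VanishesFrom k v → VanishesFrom k (a · v)
  vanishesFrom-· k a v van j k≤j = trans (lookup-· a v j) (trans (cong (a *_) (van j k≤j)) (zeroʳ a))

  vanishesFrom-⊕ : ∀ k u v → VanishesFrom k u → VanishesFrom k v → VanishesFrom k (u ⊕ v)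
  vanishesFrom-⊕ k u v van van′ j k≤j = trans (lookup-⊕ u v j) (trans (cong₂ _+_ (van j k≤j) (van′ j k≤j)) (+-identityˡ 0#))

  vanishesFrom? : ∀ k v → Dec (VanishesFrom k v)
  vanishesFrom? k v = Finₚ.all? (λ j → (k ℕ.≤? toℕ j) →-dec (lookup v j ≟C 0#))

  -- The subspace spanned by the first `k` coordinate vectors. This chain ends with all points after
  -- `suc r` steps, which fixes the index of the q-integer `N`, where `flat-size` only asserts that
  -- some index exists.
  coordinateFlat : ℕ → Subset N
  coordinateFlat k = comprehension (λ i → vanishesFrom? k (pt i))

  ∈-coordinateFlat⁺ : ∀ k {i} → VanishesFrom k (pt i) → i ∈ coordinateFlat k
  ∈-coordinateFlat⁺ k = ∈-comprehension⁺ (λ i → vanishesFrom? k (pt i))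

  ∈-coordinateFlat⁻ : ∀ k {i} → i ∈ coordinateFlat k → VanishesFrom k (pt i)
  ∈-coordinateFlat⁻ k = ∈-comprehension⁻ (λ i → vanishesFrom? k (pt i))

  coordinateFlat-flat : ∀ k → Flat (coordinateFlat k)
  coordinateFlat-flat k i j l i∈ j∈ (a , b , l≡) = ∈-coordinateFlat⁺ k (subst (VanishesFrom k) (sym l≡)
    (vanishesFrom-⊕ k (a · pt i) (b · pt j) (vanishesFrom-· k a (pt i) (∈-coordinateFlat⁻ k i∈)) (vanishesFrom-· k b (pt j) (∈-coordinateFlat⁻ k j∈))))

  span-coordinateFlat : ∀ k {v} → VanishesFrom k v → Span (coordinateFlat k) v
  span-coordinateFlat k {v} van with v ≟V 𝟎
  ... | yes v≡0 = inj₁ v≡0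
  ... | no  v≢0 with representative v≢0
  ...   | i , (a , v≡) , (y , i≡) = inj₂ (i , ∈-coordinateFlat⁺ k (subst (VanishesFrom k) (sym i≡) (vanishesFrom-· k y v van)) , a , v≡)

  lookup-injective : ∀ {n} {u v : Vec Carrier n} → (∀ i → lookup u i ≡ lookup v i) → u ≡ v
  lookup-injective {u = []}    {[]}    eq = refl
  lookup-injective {u = x ∷ u} {y ∷ v} eq = cong₂ _∷_ (eq zero) (lookup-injective (eq ∘ suc))

  ∣coordinateFlat∣ : ∀ k → k ≤ suc r → ∣ coordinateFlat k ∣ ≡ qint q k
  ∣coordinateFlat∣ zero _ = trans (cong ∣_∣ (Empty-unique λ (i , i∈) → nonzero i (lookup-injective
    (λ j → trans (∈-coordinateFlat⁻ 0 i∈ j z≤n) (sym (Vₚ.lookup-replicate j 0#)))))) (∣⊥∣≡0 N)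
  ∣coordinateFlat∣ (suc k) k<r with representative {𝟎 [ fromℕ< k<r ]≔ 1#} unit≢0
    where
    unit≢0 : 𝟎 [ fromℕ< k<r ]≔ 1# ≢ 𝟎
    unit≢0 eq = 0≢1 (begin
      0#                                                   ≡⟨ Vₚ.lookup-replicate (fromℕ< k<r) 0# ⟨
      lookup 𝟎 (fromℕ< k<r)                                ≡⟨ cong (λ v → lookup v (fromℕ< k<r)) eq ⟨
      lookup (𝟎 [ fromℕ< k<r ]≔ 1#) (fromℕ< k<r)           ≡⟨ Vₚ.lookup∘updateAt (fromℕ< k<r) 𝟎 ⟩
      1#                                                   ∎)
      where open ≡-Reasoning
  ... | p , (a , unit≡) , (y , p≡) = begin
    -- The next coordinate subspace is the join with the point of the unit vector at `k`: minimality
    -- gives one inclusion, splitting off the coordinate at `k` the other.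
    ∣ coordinateFlat (suc k) ∣         ≡⟨ cong ∣_∣ (⊆-antisym ⊆J (J-minimal _ (coordinateFlat-flat (suc k)) step p∈)) ⟩
    ∣ J ∣                              ≡⟨ ∣J∣ ⟩
    suc (q ℕ.* ∣ coordinateFlat k ∣)   ≡⟨ cong (λ n → suc (q ℕ.* n)) (∣coordinateFlat∣ k (ℕₚ.<⇒≤ k<r)) ⟩
    suc (q ℕ.* qint q k)               ≡⟨ qint-suc q k ⟨
    qint q (suc k)                     ∎
    where
    open ≡-Reasoning
    κ = fromℕ< k<r
    unit = 𝟎 [ κ ]≔ 1#
    unit-κ : lookup unit κ ≡ 1#
    unit-κ = Vₚ.lookup∘updateAt κ 𝟎
    unit-other : ∀ j → j ≢ κ → lookup unit j ≡ 0#
    unit-other j j≢κ = trans (Vₚ.lookup∘updateAt′ j κ j≢κ 𝟎) (Vₚ.lookup-replicate j 0#)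
    unit-vanishes : VanishesFrom (suc k) unit
    unit-vanishes j k<j = unit-other j (λ { refl → ℕₚ.<⇒≢ k<j (sym (Finₚ.toℕ-fromℕ< k<r)) })
    p∈ : p ∈ coordinateFlat (suc k)
    p∈ = ∈-coordinateFlat⁺ (suc k) (subst (VanishesFrom (suc k)) (sym p≡) (vanishesFrom-· (suc k) y unit unit-vanishes))
    p∉ : p ∉ coordinateFlat k
    p∉ p∈ = 0≢1 (begin
      0#                        ≡⟨ zeroʳ a ⟨
      a * 0#                    ≡⟨ cong (a *_) (∈-coordinateFlat⁻ k p∈ κ (ℕₚ.≤-reflexive (sym (Finₚ.toℕ-fromℕ< k<r)))) ⟨
      a * lookup (pt p) κ       ≡⟨ lookup-· a (pt p) κ ⟨
      lookup (a · pt p) κ       ≡⟨ cong (λ v → lookup v κ) unit≡ ⟨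
      lookup unit κ             ≡⟨ unit-κ ⟩
      1#                        ∎)
    step : coordinateFlat k ⊆ coordinateFlat (suc k)
    step i∈ = ∈-coordinateFlat⁺ (suc k) (λ j k<j → ∈-coordinateFlat⁻ k i∈ j (ℕₚ.<⇒≤ k<j))
    open Join (coordinateFlat-flat k) p∉
    ⊆J : coordinateFlat (suc k) ⊆ J
    ⊆J {i} i∈ = ∈J⁺ (x * a , u , span-coordinateFlat k u-vanishes , i≡)
      where
      v = pt i
      x = lookup v κ
      -- The vector `v` with its coordinate at `κ` cleared.
      u = (- 1#) · x · unit ⊕ v
      i≡ : v ≡ (x * a) · pt p ⊕ u
      i≡ = begin
        v                                             ≡⟨ ⊕-identityˡ v ⟨
        𝟎 ⊕ v                                         ≡⟨ cong (_⊕ v) (·-inverse (x · unit)) ⟨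
        x · unit ⊕ (- 1#) · x · unit ⊕ v              ≡⟨ ⊕-assoc (x · unit) ((- 1#) · x · unit) v ⟩
        x · unit ⊕ u                                  ≡⟨ cong (_⊕ u) (trans (cong (x ·_) unit≡) (·-assoc x a (pt p))) ⟩
        (x * a) · pt p ⊕ u                            ∎
      u-lookup : ∀ j → lookup u j ≡ (- 1#) * (x * lookup unit j) + lookup v j
      u-lookup j = trans (lookup-⊕ ((- 1#) · x · unit) v j) (cong (_+ lookup v j)
        (trans (lookup-· (- 1#) (x · unit) j) (cong ((- 1#) *_) (lookup-· x unit j))))
      u-vanishes : VanishesFrom k u
      u-vanishes j k≤j with j Fin.≟ κ
      ... | yes refl = begin
        lookup u κ                                    ≡⟨ u-lookup κ ⟩
        (- 1#) * (x * lookup unit κ) + x              ≡⟨ cong (λ z → (- 1#) * z + x) (trans (cong (x *_) unit-κ) (*-identityʳ x)) ⟩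
        (- 1#) * x + x                                ≡⟨ cong (_+ x) (trans (sym (-‿distribˡ-* 1# x)) (cong -_ (*-identityˡ x))) ⟩
        - x + x                                       ≡⟨ -‿inverseˡ x ⟩
        0#                                            ∎
      ... | no j≢κ = begin
        lookup u j                                    ≡⟨ u-lookup j ⟩
        (- 1#) * (x * lookup unit j) + lookup v j     ≡⟨ cong₂ (λ z w → (- 1#) * (x * z) + w) (unit-other j j≢κ)
                                                           (∈-coordinateFlat⁻ (suc k) i∈ j (ℕₚ.≤∧≢⇒< k≤j (λ k≡j → j≢κ (Finₚ.toℕ-injective (trans (sym k≡j) (sym (Finₚ.toℕ-fromℕ< k<r))))))) ⟩
        (- 1#) * (x * 0#) + 0#                        ≡⟨ trans (+-identityʳ _) (trans (cong ((- 1#) *_) (zeroʳ x)) (zeroʳ (- 1#))) ⟩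
        0#                                            ∎

  points : N ≡ qint q (suc r)
  points = trans (sym (∣⊤∣≡n N)) (trans (cong ∣_∣ (⊆-antisym ⊤⊆ (λ _ → ∈⊤))) (∣coordinateFlat∣ (suc r) ℕₚ.≤-refl))
    where
    ⊤⊆ : ⊤ ⊆ coordinateFlat (suc r)
    ⊤⊆ {i} _ = ∈-coordinateFlat⁺ (suc r) (λ j r<j → contradiction (Finₚ.toℕ<n j) (ℕₚ.≤⇒≯ r<j))

  projectiveFlats : ProjectiveFlats q r Flat
  projectiveFlats = record
    { q≢0   = q-nonZero
    ; total = points
    ; size  = flat-size
    ; empty = empty-flat
    ; join  = λ S p flat p∉S → let open Join flat p∉S in J , J-flat , S⊆J , p∈J , ∣J∣ , J-minimal
    }

-- The degree formula

theorem7p9 : (q r : ℕ) → 1 ≤ r → (F : FiniteField q) →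
    (N : ℕ) (pt : Fin N → Vec (FiniteField.Carrier F) (suc r)) → IsProjRep F r N pt →
    (D : List (Subset N) → ℚ) →
    IsDegreeMap r (λ S → IsProjSubspace F pt S × Nonempty S × Proper S) D →
    (a : List ℕ → ℚ) → IsRemixedEulerianAt q r a →
    (c : List ℕ) → length c ≡ r → sum c ≡ r →
    evalP D (gammaMono N q c) ≡ ℕtoℚ (q ^ (suc r C 2)) ℚ.* a c
theorem7p9 q r 1≤r F N pt rep D isDegree a isRemixed c len sum≡ = begin
  evalP D (gammaMono N q c)           ≡⟨ evalP-gammaMonoFrom q 1 c D ⟩
  evalγ (indices q 1 c) D             ≡⟨ evalγ-γ* chow (indices q 1 c) [] D
                                           (trans (ℕₚ.+-identityʳ _) (trans (length-indices q 1 c) sum≡))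
                                           (λ m _ → cong D (sym (++-identityʳ m))) ⟩
  -- The comparison solution is the multiple `κ` of `a`, in the two-term form that `harmonic-lin`
  -- produces.
  mixed chow c                        ≡⟨ harmonic-unique (mixed-harmonic chow) (harmonic-lin κ 0ℚ step step) initial c (comp len sum≡) ⟩
  κ ℚ.* a c ℚ.+ 0ℚ ℚ.* a c            ≡⟨ drop-zero (a c) ⟩
  κ ℚ.* a c                           ∎
  where
  open ≡-Reasoning
  open Projective (ProjectiveSpace.projectiveFlats F rep)
  open IsRemixedEulerianAt isRemixed
  κ = ℕtoℚ (q ^ (suc r C 2))
  chow : ChowFunctional NPFlat r D
  chow = record { IsDegreeMap isDegree }
  drop-zero : ∀ x → κ ℚ.* x ℚ.+ 0ℚ ℚ.* x ≡ κ ℚ.* x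
  drop-zero x = trans (cong (κ ℚ.* x ℚ.+_) (ℚₚ.*-zeroˡ x)) (ℚₚ.+-identityʳ (κ ℚ.* x))
  initial : mixed chow (replicate r 1) ≡ κ ℚ.* a (replicate r 1) ℚ.+ 0ℚ ℚ.* a (replicate r 1)
  initial = begin
    -- The induction over flags starts at the empty flag, with all `r` classes still to be applied.
    mixed chow (replicate r 1)                                 ≡⟨ mixed-flag chow (IsDegreeMap.flag isDegree) r 0 refl [] ⟩
    ℕtoℚ (flag-value q 0 r)                                    ≡⟨ cong ℕtoℚ (flag-value-formula q 0 r) ⟩
    ℕtoℚ (q ^ (suc r C 2) ℕ.* qfact q r)                       ≡⟨ ℕtoℚ-* (q ^ (suc r C 2)) (qfact q r) ⟩
    κ ℚ.* ℕtoℚ (qfact q r)                                     ≡⟨ cong (κ ℚ.*_) base ⟨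
    κ ℚ.* a (replicate r 1)                                    ≡⟨ drop-zero (a (replicate r 1)) ⟨
    κ ℚ.* a (replicate r 1) ℚ.+ 0ℚ ℚ.* a (replicate r 1)       ∎
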